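{- Let $\beta$ be a weak composition of $n$ and let $k\in\mathbb{Z}_{\ge0}$. Then \[ \sum_{\mu\in\mathcal{OP}_{\beta,k}} q^{\mathrm{inv}(\mu)}=\sum_{\mu\in\mathcal{OP}_{\beta,k}} q^{\mathrm{minimaj}(\mu)}. \]
   Context: A weak composition $\beta=(\beta_1,\beta_2,\dots,\beta_m)$ of $n$ is a finite sequence of nonnegative integers summing to $n$. An ordered multiset partition of weight $\beta$ is a sequence $\mu=(B_1|\dots|B_k)$ of nonempty sets of positive integers (blocks; no block contains a repeated letter) whose multiset union is $\{1^{\beta_1},2^{\beta_2},\dots\}$. $\mathcal{OP}_{\beta,k}$ is the set of ordered multiset partitions of weight $\beta$ with $k$ blocks. An inversion of $\mu$ is a pair of letters $i<j$ such that $i=\min(B_m)$ and $j\in B_\ell$ for some $\ell<m$ (counted once for each such occurrence of $j$ in a block $B_\ell$); $\mathrm{inv}(\mu)$ is the number of inversions. For a word $w=w_1\dots w_n$, $\mathrm{maj}(w)=\sum_{i:w_i>w_{i+1}}i$. $W(\mu)$ is the set of words obtained by writing the blocks of $\mu$ in order with the letters within each block in any order, and $\mathrm{minimaj}(\mu)=\min\{\mathrm{maj}(w):w\in W(\mu)\}$. -}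

module Defs where

open import Data.Nat using (ℕ; zero; suc; _+_; _≡ᵇ_; _<ᵇ_; _⊓_)
open import Data.Bool using (Bool; true; false; _∧_; not; if_then_else_)
open import Data.List using (List; []; _∷_; length; concat; concatMap; map; upTo; foldr; sum; lookup)

-- Letters are positive integers, represented by ℕ (the letter 0 is excluded by the
-- predicate isOP below).  A block (a finite nonempty set of positive integers) is
-- represented canonically by the strictly increasing list of its elements.
-- An ordered multiset partition is a list of blocks.

strictInc : List ℕ → Bool
strictInc []            = true
strictInc (x ∷ [])      = true
strictInc (x ∷ y ∷ xs)  = (x <ᵇ y) ∧ strictInc (y ∷ xs)

allPos : List ℕ → Bool
allPos []       = true
allPos (x ∷ xs) = not (x ≡ᵇ 0) ∧ allPos xs

isBlock : List ℕ → Bool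
isBlock []       = false
isBlock (x ∷ xs) = strictInc (x ∷ xs) ∧ allPos (x ∷ xs)

allBlocks : List (List ℕ) → Bool
allBlocks []       = true
allBlocks (B ∷ Bs) = isBlock B ∧ allBlocks Bs

count : ℕ → List ℕ → ℕ
count i []       = 0
count i (x ∷ xs) = (if i ≡ᵇ x then 1 else 0) + count i xs

-- multiplicity prescribed by the weak composition β for letter i (1-indexed),
-- and 0 for letters beyond the length of β (and for i = 0)
mult : List ℕ → ℕ → ℕ
mult β       zero          = 0
mult []      (suc i)       = 0
mult (b ∷ β) (suc zero)    = b
mult (b ∷ β) (suc (suc i)) = mult β (suc i)

allLe : ℕ → List ℕ → Bool
allLe m []       = true
allLe m (x ∷ xs) = (x <ᵇ suc m) ∧ allLe m xs

hasWeight : List ℕ → List (List ℕ) → Bool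
hasWeight β μ =
  allLe (length β) (concat μ) ∧
  foldr (λ i r → (count (suc i) (concat μ) ≡ᵇ mult β (suc i)) ∧ r) true (upTo (length β))

isOP : List ℕ → ℕ → List (List ℕ) → Bool
isOP β k μ = allBlocks μ ∧ hasWeight β μ ∧ (length μ ≡ᵇ k)

countGreater : ℕ → List ℕ → ℕ
countGreater a []       = 0
countGreater a (x ∷ xs) = (if a <ᵇ x then 1 else 0) + countGreater a xs

-- inv, computed by scanning blocks left to right; `prev` is the list of all
-- letters (with multiplicity) in the earlier blocks.  Blocks are increasing,
-- so min(B) is the head of B.
invAux : List ℕ → List (List ℕ) → ℕ
invAux prev []             = 0
invAux prev ([] ∷ Bs)      = invAux prev Bs
invAux prev ((a ∷ B) ∷ Bs) = countGreater a prev + invAux (prev Data.List.++ (a ∷ B)) Bs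

inv : List (List ℕ) → ℕ
inv μ = invAux [] μ

majFrom : ℕ → List ℕ → ℕ
majFrom i []           = 0
majFrom i (x ∷ [])     = 0
majFrom i (x ∷ y ∷ xs) = (if y <ᵇ x then i else 0) + majFrom (suc i) (y ∷ xs)

maj : List ℕ → ℕ
maj w = majFrom 1 w

insertions : ℕ → List ℕ → List (List ℕ)
insertions x []       = (x ∷ []) ∷ []
insertions x (y ∷ ys) = (x ∷ y ∷ ys) ∷ map (y ∷_) (insertions x ys)

perms : List ℕ → List (List ℕ)
perms []       = [] ∷ []
perms (x ∷ xs) = concatMap (insertions x) (perms xs)

words : List (List ℕ) → List (List ℕ)
words []       = [] ∷ []
words (B ∷ Bs) = concatMap (λ u → map (u Data.List.++_) (words Bs)) (perms B)

-- minimum of a nonempty list (default 0 for the empty list, which never occurs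
-- for words μ since words μ is always nonempty)
minimum : List ℕ → ℕ
minimum []       = 0
minimum (x ∷ []) = x
minimum (x ∷ y ∷ xs) = x ⊓ minimum (y ∷ xs)

minimaj : List (List ℕ) → ℕ
minimaj μ = minimum (map maj (words μ))

{-# OPTIONS --safe #-}
module Submission where

-- Consider the polynomials G₀ = 1 and
--   Gₖ₊₁(v₁,…,vₙ) = Σᵢ vᵢ ∏_{j>i} (1 + vⱼ) Gₖ(v₁,…,vᵢ, q vᵢ₊₁,…, q vₙ).
-- Removing the last block, with minimum i, from an ordered multiset partition lowers inv by the
-- number of letters > i in the remaining blocks; hence Gₖ(x₁,…,xₙ) enumerates inv.
--
-- For minimaj, the optimal word is built from the right: in front of a letter r, a block is
-- written increasingly with respect to the cyclic order r+1 < … < n < 1 < … < r.  Removing the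
-- last block thus gives the same recursion, but for the variables listed in that cyclic order
-- (those of the letters > r being multiplied by q) and with a new order determined by the first
-- letter of the removed block.  The two recursions agree because Gₖ is symmetric, which is proved
-- by induction on k together with the exchange relation
--   a Gₖ(a,b) + b (1 + a) Gₖ(qa,b) = b Gₖ(a,b) + a (1 + b) Gₖ(a,qb)
-- in any two adjacent variables.

open import Defs
open import Algebra.Bundles using (CommutativeSemiring)
open import Algebra.Structures using (IsCommutativeMonoid)
open import Algebra.Structures.Biased using (isCommutativeSemiringˡ)
open import Data.Bool.Base using (Bool; true; false; if_then_else_; T; _∧_)
open import Data.Bool.Properties using (T?; T-∧; T-irrelevant)
open import Data.Empty using (⊥-elim)
open import Data.Fin.Base using (Fin; toℕ; fromℕ<) renaming (zero to fzero; suc to fsuc)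
open import Data.Fin.Properties using (toℕ<n; toℕ-fromℕ<)
open import Data.List.Base using (List; []; _∷_; _++_; map; length; concat; filter; [_]; _∷ʳ_; cartesianProductWith; foldr; upTo; applyUpTo; initLast; _∷ʳ′_; lookup)
open import Data.List.Membership.Propositional using (_∈_; find; lose)
open import Data.List.Membership.Propositional.Properties.WithK using (unique⇒irrelevant)
open import Data.List.Relation.Binary.Permutation.Propositional using (_↭_; prep; swap; ↭-sym; ↭-trans; ↭-refl)
open import Data.List.Relation.Binary.Pointwise using (Pointwise; []; _∷_)
open import Data.List.Relation.Unary.All using (All; []; _∷_)
open import Data.List.Relation.Unary.AllPairs using (AllPairs; []; _∷_)
open import Data.List.Relation.Unary.Any using (here; there; index)
open import Data.List.Relation.Unary.Any.Properties using (lookup-index)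
open import Data.List.Relation.Unary.Linked using (Linked; []; [-]; _∷_)
open import Data.List.Relation.Unary.Unique.Propositional using (Unique)
open import Data.Nat.Base using (ℕ; zero; suc; _≤_; _<_; _<ᵇ_; z≤n; s≤s; _≡ᵇ_)
open import Data.Nat.ListAction using (sum)
open import Data.Nat.Properties using (_<?_; ≤-refl; <-trans; ≤-<-trans; <-≤-trans; <⇒≤; <⇒≱; ≤⇒≯; <ᵇ-reflects-<; _≟_; <-irrefl; <-asym; <⇒<ᵇ; <ᵇ⇒<; ≡ᵇ⇒≡; ≡⇒≡ᵇ; suc-injective; ≡-irrelevant)
open import Data.Product.Base using (Σ; ∃; ∃₂; _×_; _,_; proj₁; proj₂)
open import Data.Sum.Base using (_⊎_; inj₁; inj₂)
open import Data.Unit.Base using (tt)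
open import Data.Vec.Base as Vec using (Vec; []; _∷_; zipWith; replicate; tabulate)
open import Function.Base using (_∘_; id)
open import Function.Bundles using (_↔_; _⇔_; mk⇔; mk↔ₛ′; Equivalence)
open import Function.Properties.Inverse using (↔-trans; ↔-sym)
open import Level using (Level; 0ℓ)
open import Relation.Binary.Core using (Rel)
open import Relation.Binary.PropositionalEquality using (_≡_; refl; _≢_; sym; trans; cong; cong₂; subst; module ≡-Reasoning; isEquivalence)
open import Relation.Binary.Structures using (IsEquivalence)
open import Relation.Nullary.Decidable using (¬?; Dec; does; does-⇔; _×-dec_)
open import Relation.Nullary.Reflects using (ofʸ; ofⁿ)
import Algebra.Solver.Ring.NaturalCoefficients.Default as NatSolver
import Data.List.Membership.Propositional.Properties as ∈ₚ
import Data.List.Properties as Listₚ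
import Data.List.Relation.Binary.Permutation.Propositional as Perm
import Data.List.Relation.Binary.Permutation.Propositional.Properties as Permₚ
import Data.List.Relation.Binary.Pointwise as PW
import Data.List.Relation.Unary.All as All
import Data.List.Relation.Unary.All.Properties as Allₚ
import Data.List.Relation.Unary.AllPairs as AllPairs
import Data.List.Relation.Unary.AllPairs.Properties as AllPairsₚ
import Data.List.Relation.Unary.Linked.Properties as Linkedₚ
import Data.List.Relation.Unary.Unique.Propositional.Properties as Uniqueₚ
import Data.Nat.Base as ℕ
import Data.Nat.Properties as ℕₚ
import Data.Product.Base as Product
import Data.Vec.Properties as Vecₚ

-- The exchange relation is what symmetry of Gₖ₊₁ in its first two variables amounts to. The
-- summands i = 1, 2 of Gₖ₊₁(a,b,...) are, up to the product of 1 + v over the other variables, b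
-- Gₖ(a,b) + a (1 + b) Gₖ(a,qb), the other variables being multiplied by q; if Gₖ is symmetric,
-- interchanging a and b turns this into the other side. So both properties go through the induction
-- together. All weights are treated at once: each letter carries a free variable, and the power of
-- q due to a removed block is absorbed into the variables of the remaining letters, which leaves
-- the same sum at another point. The composition β enters only when a coefficient is read off. For
-- this the identity, valid in every commutative semiring, is specialised to formal sums of
-- monomials, where an indicator function extracts one coefficient. Building words from the right
-- requires a letter after the last block. The largest letter n serves, since appending it to a word
-- creates no descent.

module Symmetric {c ℓ : Level} (S : CommutativeSemiring c ℓ) (q : CommutativeSemiring.Carrier S) where
  open CommutativeSemiring S renaming (Carrier to R; refl to ≈-refl; sym to ≈-sym; trans to ≈-trans; reflexive to ≈-reflexive)
  open NatSolver S using (solve; _:=_; _:+_; _:*_; con)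
  open import Relation.Binary.Reasoning.Setoid setoid

  -- Symmetry and the exchange relation.

  ∏1+ : List R → R
  ∏1+ []      = 1#
  ∏1+ (v ∷ l) = (1# + v) * ∏1+ l

  -- The variables already passed over are stored in `H`, so the chosen variable and those before it
  -- stay unscaled. The inductions on the list therefore concern an arbitrary exchangeable `H`
  -- instead of `G k`.
  gsum : (List R → R) → List R → R
  gsum H []      = 0#
  gsum H (t ∷ l) = t * ∏1+ l * H (t ∷ map (q *_) l) + gsum (λ l′ → H (t ∷ l′)) l

  G : ℕ → List R → R
  G zero    _ = 1#
  G (suc k)   = gsum (G k)

  -- Symmetry of G k alone does not pass to G (suc k): swapping neighbours a, b in gsum needs the
  -- relation below.  The factor u replaces a division by q in its inductive proof.
  record Exchangeable (H : List R → R) : Set (c Level.⊔ ℓ) where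
    field
      congr    : ∀ {l l′} → Pointwise _≈_ l l′ → H l ≈ H l′
      swaps    : ∀ p a b s → H (p ++ a ∷ b ∷ s) ≈ H (p ++ b ∷ a ∷ s)
      exchange : ∀ u p a b s →
        a * H (p ++ u * a ∷ u * b ∷ s) + b * (1# + u * a) * H (p ++ q * (u * a) ∷ u * b ∷ s) ≈
        b * H (p ++ u * a ∷ u * b ∷ s) + a * (1# + u * b) * H (p ++ u * a ∷ q * (u * b) ∷ s)
  open Exchangeable

  ≈*-refl : ∀ {l} → Pointwise _≈_ l l
  ≈*-refl = PW.refl ≈-refl

  map-q : ∀ {l l′} → Pointwise _≈_ l l′ → Pointwise _≈_ (map (q *_) l) (map (q *_) l′)
  map-q []       = []
  map-q (e ∷ es) = *-congˡ e ∷ map-q es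

  ∏1+-cong : ∀ {l l′} → Pointwise _≈_ l l′ → ∏1+ l ≈ ∏1+ l′
  ∏1+-cong []       = ≈-refl
  ∏1+-cong (e ∷ es) = *-cong (+-congˡ e) (∏1+-cong es)

  ∏1+-++ : ∀ l l′ → ∏1+ (l ++ l′) ≈ ∏1+ l * ∏1+ l′
  ∏1+-++ []      l′ = ≈-sym (*-identityˡ _)
  ∏1+-++ (v ∷ l) l′ = ≈-trans (*-congˡ (∏1+-++ l l′)) (≈-sym (*-assoc _ _ _))

  gsum-cong : ∀ {H H′} → (∀ {l l′} → Pointwise _≈_ l l′ → H l ≈ H′ l′) →
              ∀ {l l′} → Pointwise _≈_ l l′ → gsum H l ≈ gsum H′ l′
  gsum-cong h []       = ≈-refl
  gsum-cong h (e ∷ es) =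
    +-cong (*-cong (*-cong e (∏1+-cong es)) (h (e ∷ map-q es))) (gsum-cong (λ es′ → h (e ∷ es′)) es)

  tail-exchangeable : ∀ {H} → Exchangeable H → ∀ t → Exchangeable (λ l → H (t ∷ l))
  tail-exchangeable h t = record
    { congr    = λ es → congr h (≈-refl ∷ es)
    ; swaps    = λ p → swaps h (t ∷ p)
    ; exchange = λ u p → exchange h u (t ∷ p)
    }

  -- `gsum` depends linearly on `H`. This settles the summands whose chosen variable lies beyond the
  -- exchanged pair, where the relation for `H` holds at every list.
  gsum-linear : ∀ c₁ c₂ c₃ c₄ {H₁ H₂ H₃ H₄} →
    (∀ l → c₁ * H₁ l + c₂ * H₂ l ≈ c₃ * H₃ l + c₄ * H₄ l) →
    ∀ l → c₁ * gsum H₁ l + c₂ * gsum H₂ l ≈ c₃ * gsum H₃ l + c₄ * gsum H₄ l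
  gsum-linear c₁ c₂ c₃ c₄ h [] =
    solve 4 (λ a b c d → a :* con 0 :+ b :* con 0 := c :* con 0 :+ d :* con 0) ≈-refl c₁ c₂ c₃ c₄
  gsum-linear c₁ c₂ c₃ c₄ {H₁} {H₂} {H₃} {H₄} h (t ∷ l) = begin
    c₁ * (k * x₁ + y₁) + c₂ * (k * x₂ + y₂)      ≈⟨ regroup k c₁ c₂ x₁ x₂ y₁ y₂ ⟩
    k * (c₁ * x₁ + c₂ * x₂) + (c₁ * y₁ + c₂ * y₂) ≈⟨ +-cong (*-congˡ (h _)) (gsum-linear c₁ c₂ c₃ c₄ (λ l′ → h (t ∷ l′)) l) ⟩
    k * (c₃ * x₃ + c₄ * x₄) + (c₃ * y₃ + c₄ * y₄) ≈⟨ regroup k c₃ c₄ x₃ x₄ y₃ y₄ ⟨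
    c₃ * (k * x₃ + y₃) + c₄ * (k * x₄ + y₄)      ∎
    where
    k  = t * ∏1+ l
    x₁ = H₁ (t ∷ map (q *_) l)
    x₂ = H₂ (t ∷ map (q *_) l)
    x₃ = H₃ (t ∷ map (q *_) l)
    x₄ = H₄ (t ∷ map (q *_) l)
    y₁ = gsum (λ l′ → H₁ (t ∷ l′)) l
    y₂ = gsum (λ l′ → H₂ (t ∷ l′)) l
    y₃ = gsum (λ l′ → H₃ (t ∷ l′)) l
    y₄ = gsum (λ l′ → H₄ (t ∷ l′)) l
    regroup = solve 7 (λ k c d x y v w → c :* (k :* x :+ v) :+ d :* (k :* y :+ w) :=
                                         k :* (c :* x :+ d :* y) :+ (c :* v :+ d :* w)) ≈-refl

  module _ {H : List R → R} (h : Exchangeable H) where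

    gsum-swap₀ : ∀ a b s → gsum H (a ∷ b ∷ s) ≈ gsum H (b ∷ a ∷ s)
    gsum-swap₀ a b s = begin
      a * ((1# + b) * P) * Z + (b * P * X + Y)   ≈⟨ collect a b P Z X Y ⟩
      P * (b * X + a * (1# + b) * Z) + Y         ≈⟨ +-congʳ (*-congˡ core) ⟩
      P * (a * X′ + b * (1# + a) * Z′) + Y       ≈⟨ +-congˡ (gsum-cong tails (≈*-refl {s})) ⟩
      P * (a * X′ + b * (1# + a) * Z′) + Y′      ≈⟨ collect b a P Z′ X′ Y′ ⟨
      b * ((1# + a) * P) * Z′ + (a * P * X′ + Y′) ∎
      where
      P  = ∏1+ s
      s′ = map (q *_) s
      Z  = H (a ∷ q * b ∷ s′)
      X  = H (a ∷ b ∷ s′)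
      Z′ = H (b ∷ q * a ∷ s′)
      X′ = H (b ∷ a ∷ s′)
      Y  = gsum (λ l → H (a ∷ b ∷ l)) s
      Y′ = gsum (λ l → H (b ∷ a ∷ l)) s
      collect = solve 6 (λ a b P Z X Y → a :* ((con 1 :+ b) :* P) :* Z :+ (b :* P :* X :+ Y) :=
                                         P :* (b :* X :+ a :* (con 1 :+ b) :* Z) :+ Y) ≈-refl
      tails : ∀ {l l′} → Pointwise _≈_ l l′ → H (a ∷ b ∷ l) ≈ H (b ∷ a ∷ l′)
      tails es = ≈-trans (swaps h [] a b _) (congr h (≈-refl ∷ ≈-refl ∷ es))
      ι = *-identityˡ
      core : b * X + a * (1# + b) * Z ≈ a * X′ + b * (1# + a) * Z′
      core = begin
        b * X + a * (1# + b) * Z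
          ≈⟨ +-cong (*-congˡ (congr h (ι a ∷ ι b ∷ ≈*-refl)))
                    (*-cong (*-congˡ (+-congˡ (ι b))) (congr h (ι a ∷ *-congˡ (ι b) ∷ ≈*-refl))) ⟨
        _ ≈⟨ exchange h 1# [] a b s′ ⟨
        _ ≈⟨ +-cong (*-congˡ (congr h (ι a ∷ ι b ∷ ≈*-refl)))
                    (*-cong (*-congˡ (+-congˡ (ι a))) (congr h (*-congˡ (ι a) ∷ ι b ∷ ≈*-refl))) ⟩
        a * X + b * (1# + a) * H (q * a ∷ b ∷ s′)
          ≈⟨ +-cong (*-congˡ (swaps h [] a b s′)) (*-congˡ (swaps h [] (q * a) b s′)) ⟩
        a * X′ + b * (1# + a) * Z′ ∎

    -- The summands choosing a member of the pair split into two instances of the relation for `H`: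
    -- one at `a`, `b` with factor `u * b`, one at `a`, `q * b` with factor `u * a * (1# + u * b)`.
    gsum-exchange₀ : ∀ u a b s →
      a * gsum H (u * a ∷ u * b ∷ s) + b * (1# + u * a) * gsum H (q * (u * a) ∷ u * b ∷ s) ≈
      b * gsum H (u * a ∷ u * b ∷ s) + a * (1# + u * b) * gsum H (u * a ∷ q * (u * b) ∷ s)
    gsum-exchange₀ u a b s = begin
      a * gsum H (u * a ∷ u * b ∷ s) + b * (1# + u * a) * gsum H (q * (u * a) ∷ u * b ∷ s)
        ≈⟨ lhs u a b q P X Y Z V TX TY ⟩
      P * (u * b * (a * X + b * (1# + u * a) * Y) + u * a * (1# + u * b) * (a * Z + q * b * (1# + u * a) * V))
        + (a * TX + b * (1# + u * a) * TY)
        ≈⟨ +-cong (*-congˡ (+-cong (*-congˡ (exchange h u [] a b s′)) (*-congˡ star₂)))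
                  (gsum-linear a (b * (1# + u * a)) b (a * (1# + u * b)) (exchange h u [] a b) s) ⟩
      P * (u * b * (b * X + a * (1# + u * b) * Z) + u * a * (1# + u * b) * (q * b * Z + a * (1# + q * (u * b)) * W))
        + (b * TX + a * (1# + u * b) * TZ)
        ≈⟨ rhs u a b q P X Z W TX TZ ⟨
      b * gsum H (u * a ∷ u * b ∷ s) + a * (1# + u * b) * gsum H (u * a ∷ q * (u * b) ∷ s) ∎
      where
      P  = ∏1+ s
      s′ = map (q *_) s
      X  = H (u * a ∷ u * b ∷ s′)
      Y  = H (q * (u * a) ∷ u * b ∷ s′)
      Z  = H (u * a ∷ q * (u * b) ∷ s′)
      V  = H (q * (u * a) ∷ q * (u * b) ∷ s′)
      W  = H (u * a ∷ q * (q * (u * b)) ∷ s′)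
      TX = gsum (λ l → H (u * a ∷ u * b ∷ l)) s
      TY = gsum (λ l → H (q * (u * a) ∷ u * b ∷ l)) s
      TZ = gsum (λ l → H (u * a ∷ q * (u * b) ∷ l)) s
      comm₃ : u * (q * b) ≈ q * (u * b)
      comm₃ = solve 3 (λ u q b → u :* (q :* b) := q :* (u :* b)) ≈-refl u q b
      star₂ : a * Z + q * b * (1# + u * a) * V ≈ q * b * Z + a * (1# + q * (u * b)) * W
      star₂ = begin
        _ ≈⟨ +-cong (*-congˡ (congr h (≈-refl ∷ comm₃ ∷ ≈*-refl)))
                    (*-congˡ (congr h (≈-refl ∷ comm₃ ∷ ≈*-refl))) ⟨
        _ ≈⟨ exchange h u [] a (q * b) s′ ⟩
        _ ≈⟨ +-cong (*-congˡ (congr h (≈-refl ∷ comm₃ ∷ ≈*-refl)))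
                    (*-cong (*-congˡ (+-congˡ comm₃)) (congr h (≈-refl ∷ *-congˡ comm₃ ∷ ≈*-refl))) ⟩
        _ ∎
      lhs = solve 11 (λ u a b q P X Y Z V TX TY →
        a :* (u :* a :* ((con 1 :+ u :* b) :* P) :* Z :+ (u :* b :* P :* X :+ TX)) :+
        b :* (con 1 :+ u :* a) :* (q :* (u :* a) :* ((con 1 :+ u :* b) :* P) :* V :+ (u :* b :* P :* Y :+ TY)) :=
        P :* (u :* b :* (a :* X :+ b :* (con 1 :+ u :* a) :* Y) :+
              u :* a :* (con 1 :+ u :* b) :* (a :* Z :+ q :* b :* (con 1 :+ u :* a) :* V)) :+
        (a :* TX :+ b :* (con 1 :+ u :* a) :* TY)) ≈-refl
      rhs = solve 10 (λ u a b q P X Z W TX TZ →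
        b :* (u :* a :* ((con 1 :+ u :* b) :* P) :* Z :+ (u :* b :* P :* X :+ TX)) :+
        a :* (con 1 :+ u :* b) :* (u :* a :* ((con 1 :+ q :* (u :* b)) :* P) :* W :+ (q :* (u :* b) :* P :* Z :+ TZ)) :=
        P :* (u :* b :* (b :* X :+ a :* (con 1 :+ u :* b) :* Z) :+
              u :* a :* (con 1 :+ u :* b) :* (q :* b :* Z :+ a :* (con 1 :+ q :* (u :* b)) :* W)) :+
        (b :* TX :+ a :* (con 1 :+ u :* b) :* TZ)) ≈-refl

  gsum-swap : ∀ {H} → Exchangeable H → ∀ p a b s → gsum H (p ++ a ∷ b ∷ s) ≈ gsum H (p ++ b ∷ a ∷ s)
  gsum-swap h []      a b s = gsum-swap₀ h a b s
  gsum-swap {H} h (t ∷ p) a b s = +-cong (*-cong (*-congˡ prod) heads) (gsum-swap (tail-exchangeable h t) p a b s)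
    where
    prod : ∏1+ (p ++ a ∷ b ∷ s) ≈ ∏1+ (p ++ b ∷ a ∷ s)
    prod = begin
      ∏1+ (p ++ a ∷ b ∷ s)       ≈⟨ ∏1+-++ p _ ⟩
      ∏1+ p * ∏1+ (a ∷ b ∷ s)    ≈⟨ *-congˡ (solve 3 (λ a b P → (con 1 :+ a) :* ((con 1 :+ b) :* P) := (con 1 :+ b) :* ((con 1 :+ a) :* P)) ≈-refl a b (∏1+ s)) ⟩
      ∏1+ p * ∏1+ (b ∷ a ∷ s)    ≈⟨ ∏1+-++ p _ ⟨
      ∏1+ (p ++ b ∷ a ∷ s)       ∎
    heads : H (t ∷ map (q *_) (p ++ a ∷ b ∷ s)) ≈ H (t ∷ map (q *_) (p ++ b ∷ a ∷ s))
    heads rewrite Listₚ.map-++ (q *_) p (a ∷ b ∷ s) | Listₚ.map-++ (q *_) p (b ∷ a ∷ s) =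
      swaps h (t ∷ map (q *_) p) (q * a) (q * b) (map (q *_) s)

  -- If the chosen variable `t` precedes the pair, both members reach `H` multiplied by `q`, so the
  -- relation is used at `q * u`. The coefficient `1# + u * a` outside completes the product over
  -- the variables after `t` to a factor common to all terms and leaves `1# + q * u * a`, as that
  -- instance demands.
  gsum-exchange : ∀ {H} → Exchangeable H → ∀ u p a b s →
      a * gsum H (p ++ u * a ∷ u * b ∷ s) + b * (1# + u * a) * gsum H (p ++ q * (u * a) ∷ u * b ∷ s) ≈
      b * gsum H (p ++ u * a ∷ u * b ∷ s) + a * (1# + u * b) * gsum H (p ++ u * a ∷ q * (u * b) ∷ s)
  gsum-exchange h u [] a b s = gsum-exchange₀ h u a b s
  gsum-exchange {H} h u (t ∷ p) a b s = begin
    a * (t * ∏1+ lx * H (t ∷ map (q *_) lx) + gx) + b * (1# + u * a) * (t * ∏1+ ly * H (t ∷ map (q *_) ly) + gy)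
      ≈⟨ +-cong (*-congˡ (+-congʳ (*-cong (*-congˡ (prod _ _)) (heads (≈-sym (*-assoc _ _ _)) (≈-sym (*-assoc _ _ _))))))
                (*-congˡ (+-congʳ (*-cong (*-congˡ (prod _ _)) (heads (*-congˡ (≈-sym (*-assoc _ _ _))) (≈-sym (*-assoc _ _ _)))))) ⟩
    a * (t * (Q * ((1# + u * a) * ((1# + u * b) * P))) * X + gx) +
    b * (1# + u * a) * (t * (Q * ((1# + q * (u * a)) * ((1# + u * b) * P))) * Y + gy)
      ≈⟨ lhs u a b q t Q P X Y gx gy ⟩
    t * Q * P * ((1# + u * a) * (1# + u * b)) * (a * X + b * (1# + q * u * a) * Y) + (a * gx + b * (1# + u * a) * gy)
      ≈⟨ +-cong (*-congˡ (exchange h (q * u) (t ∷ p′) a b s′)) (gsum-exchange (tail-exchangeable h t) u p a b s) ⟩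
    t * Q * P * ((1# + u * a) * (1# + u * b)) * (b * X + a * (1# + q * u * b) * Z) + (b * gx + a * (1# + u * b) * gz)
      ≈⟨ rhs u a b q t Q P X Z gx gz ⟨
    b * (t * (Q * ((1# + u * a) * ((1# + u * b) * P))) * X + gx) +
    a * (1# + u * b) * (t * (Q * ((1# + u * a) * ((1# + q * (u * b)) * P))) * Z + gz)
      ≈⟨ +-cong (*-congˡ (+-congʳ (*-cong (*-congˡ (prod _ _)) (heads (≈-sym (*-assoc _ _ _)) (≈-sym (*-assoc _ _ _))))))
                (*-congˡ (+-congʳ (*-cong (*-congˡ (prod _ _)) (heads (≈-sym (*-assoc _ _ _)) (*-congˡ (≈-sym (*-assoc _ _ _))))))) ⟨
    b * (t * ∏1+ lx * H (t ∷ map (q *_) lx) + gx) + a * (1# + u * b) * (t * ∏1+ lz * H (t ∷ map (q *_) lz) + gz) ∎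
    where
    P  = ∏1+ s
    Q  = ∏1+ p
    s′ = map (q *_) s
    p′ = map (q *_) p
    lx = p ++ u * a ∷ u * b ∷ s
    ly = p ++ q * (u * a) ∷ u * b ∷ s
    lz = p ++ u * a ∷ q * (u * b) ∷ s
    gx = gsum (λ l → H (t ∷ l)) lx
    gy = gsum (λ l → H (t ∷ l)) ly
    gz = gsum (λ l → H (t ∷ l)) lz
    X  = H (t ∷ p′ ++ q * u * a ∷ q * u * b ∷ s′)
    Y  = H (t ∷ p′ ++ q * (q * u * a) ∷ q * u * b ∷ s′)
    Z  = H (t ∷ p′ ++ q * u * a ∷ q * (q * u * b) ∷ s′)
    prod : ∀ v w → ∏1+ (p ++ v ∷ w ∷ s) ≈ Q * ((1# + v) * ((1# + w) * P))
    prod v w = ∏1+-++ p (v ∷ w ∷ s)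
    heads : ∀ {v w v′ w′} → q * v ≈ v′ → q * w ≈ w′ →
            H (t ∷ map (q *_) (p ++ v ∷ w ∷ s)) ≈ H (t ∷ p′ ++ v′ ∷ w′ ∷ s′)
    heads {v} {w} e f rewrite Listₚ.map-++ (q *_) p (v ∷ w ∷ s) =
      congr h (≈-refl ∷ PW.++⁺ (≈*-refl {p′}) (e ∷ f ∷ ≈*-refl))
    lhs = solve 11 (λ u a b q t Q P X Y gx gy →
      a :* (t :* (Q :* ((con 1 :+ u :* a) :* ((con 1 :+ u :* b) :* P))) :* X :+ gx) :+
      b :* (con 1 :+ u :* a) :* (t :* (Q :* ((con 1 :+ q :* (u :* a)) :* ((con 1 :+ u :* b) :* P))) :* Y :+ gy) :=
      t :* Q :* P :* ((con 1 :+ u :* a) :* (con 1 :+ u :* b)) :* (a :* X :+ b :* (con 1 :+ q :* u :* a) :* Y) :+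
      (a :* gx :+ b :* (con 1 :+ u :* a) :* gy)) ≈-refl
    rhs = solve 11 (λ u a b q t Q P X Z gx gz →
      b :* (t :* (Q :* ((con 1 :+ u :* a) :* ((con 1 :+ u :* b) :* P))) :* X :+ gx) :+
      a :* (con 1 :+ u :* b) :* (t :* (Q :* ((con 1 :+ u :* a) :* ((con 1 :+ q :* (u :* b)) :* P))) :* Z :+ gz) :=
      t :* Q :* P :* ((con 1 :+ u :* a) :* (con 1 :+ u :* b)) :* (b :* X :+ a :* (con 1 :+ q :* u :* b) :* Z) :+
      (b :* gx :+ a :* (con 1 :+ u :* b) :* gz)) ≈-refl

  G-exchangeable : ∀ k → Exchangeable (G k)
  G-exchangeable zero = record
    { congr    = λ _ → ≈-refl
    ; swaps    = λ _ _ _ _ → ≈-refl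
    ; exchange = λ u p a b s → solve 3 (λ u a b → a :* con 1 :+ b :* (con 1 :+ u :* a) :* con 1 :=
                                                  b :* con 1 :+ a :* (con 1 :+ u :* b) :* con 1) ≈-refl u a b
    }
  G-exchangeable (suc k) = record
    { congr    = gsum-cong (congr h)
    ; swaps    = gsum-swap h
    ; exchange = gsum-exchange h
    }
    where h = G-exchangeable k

  exchangeable-↭ : ∀ {H} → Exchangeable H → ∀ {l l′} → l ↭ l′ → H l ≈ H l′
  exchangeable-↭ h Perm.refl          = ≈-refl
  exchangeable-↭ h (prep x e)         = exchangeable-↭ (tail-exchangeable h x) e
  exchangeable-↭ h (swap x y e)       =
    ≈-trans (swaps h [] x y _) (exchangeable-↭ (tail-exchangeable (tail-exchangeable h y) x) e)
  exchangeable-↭ h (Perm.trans e₁ e₂) = ≈-trans (exchangeable-↭ h e₁) (exchangeable-↭ h e₂)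

-- The greedy word attains `minimaj`.

module Minimaj where
  open import Data.Nat.Base using (_+_)
  open import Data.Nat.Properties

  hd : ℕ → List ℕ → ℕ
  hd d []      = d
  hd d (x ∷ _) = x

  -- Before a letter s, a block is optimally written as rotate s B.  It then causes exactly one
  -- descent if it has c > 0 letters > s, right after these, and none if c = 0.
  hi lo rotate : ℕ → List ℕ → List ℕ
  hi s = filter (s <?_)
  lo s = filter (λ x → ¬? (s <? x))
  rotate s B = hi s B ++ lo s B

  first : ℕ → List ℕ → ℕ
  first s B = hd s (rotate s B)

  lead : List (List ℕ) → ℕ → ℕ
  lead []      r = r
  lead (B ∷ μ) r = first (lead μ r) B

  -- The index of the descent of a rotated block preceded by `m` letters: its `c` letters above the
  -- next letter occupy positions `m + 1` to `m + c`.
  penalty : ℕ → ℕ → ℕ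
  penalty m zero    = 0
  penalty m (suc c) = m + suc c

  -- The contribution to `maj` of the greedy word when `m` letters precede it and `r` follows. With
  -- both parameters blocks can be split off at either end.
  cost : ℕ → List (List ℕ) → ℕ → ℕ
  cost m []      r = 0
  cost m (B ∷ μ) r = penalty m (countGreater (lead μ r) B) + cost (m + length B) μ r

  greedy : List (List ℕ) → ℕ → List ℕ
  greedy []      r = []
  greedy (B ∷ μ) r = rotate (lead μ r) B ++ greedy μ r

  Increasing NonEmpty : List ℕ → Set
  Increasing = AllPairs _<_
  NonEmpty B = B ≢ []

  hd-greedy : ∀ μ r → hd r (greedy μ r) ≡ lead μ r
  hd-greedy []      r = refl
  hd-greedy (B ∷ μ) r with rotate (lead μ r) B
  ... | []    = hd-greedy μ r
  ... | x ∷ _ = refl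

  ∷ʳ-hd : ∀ r w → ∃ λ t → w ++ [ r ] ≡ hd r w ∷ t
  ∷ʳ-hd r []      = _ , refl
  ∷ʳ-hd r (x ∷ w) = _ , refl

  rotate-↭ : ∀ s B → rotate s B ↭ B
  rotate-↭ s [] = ↭-refl
  rotate-↭ s (x ∷ B) with s <ᵇ x
  ... | true  = prep x (rotate-↭ s B)
  ... | false = ↭-trans (Permₚ.shift x (hi s B) (lo s B)) (prep x (rotate-↭ s B))

  countGreater-hi : ∀ s B → countGreater s B ≡ length (hi s B)
  countGreater-hi s [] = refl
  countGreater-hi s (x ∷ B) with s <ᵇ x
  ... | true  = cong suc (countGreater-hi s B)
  ... | false = countGreater-hi s B

  countGreater-↭ : ∀ s {v B} → v ↭ B → countGreater s v ≡ countGreater s B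
  countGreater-↭ s Perm.refl = refl
  countGreater-↭ s (prep x e) = cong ((if s <ᵇ x then 1 else 0) +_) (countGreater-↭ s e)
  countGreater-↭ s (swap {xs} x y e) = trans
    (x∙yz≈y∙xz (if s <ᵇ x then 1 else 0) (if s <ᵇ y then 1 else 0) _)
    (cong (λ c → (if s <ᵇ y then 1 else 0) + ((if s <ᵇ x then 1 else 0) + c)) (countGreater-↭ s e))
    where open import Algebra.Properties.CommutativeSemigroup +-commutativeSemigroup
  countGreater-↭ s (Perm.trans e e′) = trans (countGreater-↭ s e) (countGreater-↭ s e′)

  first∈ : ∀ s {B} → NonEmpty B → first s B ∈ B
  first∈ s {B} ne = Permₚ.∈-resp-↭ (rotate-↭ s B) (hd∈ (λ e → ne (Permₚ.↭-empty-inv (subst (_ ↭_) e (↭-sym (rotate-↭ s B))))))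
    where
    hd∈ : ∀ {l} → l ≢ [] → hd s l ∈ l
    hd∈ {[]}    ne = ⊥-elim (ne refl)
    hd∈ {x ∷ l} ne = here refl

  first-above : ∀ s B → 0 < countGreater s B → s < first s B
  first-above s B pos rewrite countGreater-hi s B with hi s B | Allₚ.all-filter (s <?_) B
  ... | []    | _       = ⊥-elim (n≮0 pos)
  ... | x ∷ _ | s<x ∷ _ = s<x

  -- Falling from `x` to the later letter `f` forces a descent, and all indices are at least
  -- `suc m`.
  one-descent : ∀ m s {f x} v → f < x → f ∈ v → suc m ≤ majFrom (suc m) (x ∷ v ++ [ s ])
  one-descent m s {f} {x} (y ∷ v) f<x f∈ with y <ᵇ x | <ᵇ-reflects-< y x
  ... | true  | _ = m≤m+n _ _
  ... | false | ofⁿ y≮x with f∈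
  ...   | here refl = ⊥-elim (y≮x f<x)
  ...   | there f∈v = ≤-trans (n≤1+n _) (one-descent (suc m) s v (<-≤-trans f<x (≮⇒≥ y≮x)) f∈v)

  -- The last letter above `s` is followed by a letter at most `s`, hence by a descent; with `c`
  -- letters above `s` its index is at least `m + c`.
  penalty-≤-majFrom : ∀ m s v → penalty m (countGreater s v) ≤ majFrom (suc m) (v ++ [ s ])
  penalty-≤-majFrom m s [] = z≤n
  penalty-≤-majFrom m s (x ∷ []) with s <ᵇ x
  ... | true  = ≤-reflexive (trans (+-comm m 1) (sym (+-identityʳ _)))
  ... | false = z≤n
  penalty-≤-majFrom m s (x ∷ y ∷ v) with countGreater s (y ∷ v) in eq | penalty-≤-majFrom (suc m) s (y ∷ v)
  ... | suc c | ih = ≤-trans (helper (s <ᵇ x)) (≤-trans ih (m≤n+m _ _))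
    where
    helper : ∀ b → penalty m ((if b then 1 else 0) + suc c) ≤ suc m + suc c
    helper true  = ≤-reflexive (+-suc m (suc c))
    helper false = n≤1+n _
  ... | zero | _ with s <ᵇ x | <ᵇ-reflects-< s x
  ...   | false | _ = z≤n
  ...   | true  | ofʸ s<x with s <ᵇ y | <ᵇ-reflects-< s y
  ...     | false | ofⁿ s≮y with y <ᵇ x | <ᵇ-reflects-< y x
  ...       | true  | _ = ≤-trans (≤-reflexive (+-comm m 1)) (m≤m+n _ _)
  ...       | false | ofⁿ y≮x = ⊥-elim (y≮x (≤-<-trans (≮⇒≥ s≮y) s<x))

  countGreater-pos : ∀ s {f} v → s < f → f ∈ v → ∃ λ c → countGreater s v ≡ suc c
  countGreater-pos s (y ∷ v) s<f (here refl) with s <ᵇ y | <ᵇ-reflects-< s y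
  ... | true  | _ = _ , refl
  ... | false | ofⁿ s≮y = ⊥-elim (s≮y s<f)
  countGreater-pos s (y ∷ v) s<f (there f∈v) with countGreater-pos s v s<f f∈v
  ... | c , eq rewrite eq = _ , +-suc _ c

  countGreater-∷ : ∀ s x v → countGreater s (x ∷ v) ≤ suc (countGreater s v)
  countGreater-∷ s x v with s <ᵇ x
  ... | true  = ≤-refl
  ... | false = n≤1+n _

  -- One descent occurs on the way from `x` to `f`, at an index above `m`. Another follows the last
  -- letter above `s`, which is not earlier than `f`.
  two-descents : ∀ m s {f x} v → s < f → f < x → f ∈ v →
                 m + (m + countGreater s (x ∷ v)) ≤ majFrom (suc m) (x ∷ v ++ [ s ])
  two-descents m s {f} {x} (y ∷ v) s<f f<x f∈ =
    ≤-trans (+-monoʳ-≤ m (≤-trans (+-monoʳ-≤ m (countGreater-∷ s x (y ∷ v))) (≤-reflexive (+-suc m _)))) (go f∈)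
    where
    go : f ∈ y ∷ v → m + (suc m + countGreater s (y ∷ v)) ≤ majFrom (suc m) (x ∷ y ∷ v ++ [ s ])
    go f∈ with y <ᵇ x | <ᵇ-reflects-< y x
    go f∈ | true  | _ with countGreater s (y ∷ v) | countGreater-pos s (y ∷ v) s<f f∈ | penalty-≤-majFrom (suc m) s (y ∷ v)
    ... | _ | c , refl | bound = +-mono-≤ (n≤1+n m) bound
    go (here refl)  | false | ofⁿ y≮x = ⊥-elim (y≮x f<x)
    go (there f∈v)  | false | ofⁿ y≮x = ≤-trans (n≤1+n _) (two-descents (suc m) s v s<f (<-≤-trans f<x (≮⇒≥ y≮x)) f∈v)

  -- Here `f` plays the first letter of the rotated block. A block starting higher pays the extra
  -- `m` by a further descent: if no letter exceeds `s` the penalty is 0 and `one-descent` suffices,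
  -- otherwise `two-descents` applies.
  block-bound : ∀ m s {f} x v → f ∈ x ∷ v → (0 < countGreater s (x ∷ v) → s < f) →
    penalty m (countGreater s (x ∷ v)) + (if f <ᵇ x then m else 0) ≤ majFrom (suc m) (x ∷ v ++ [ s ])
  block-bound m s {f} x v f∈ above with f <ᵇ x | <ᵇ-reflects-< f x
  ... | false | _ = ≤-trans (≤-reflexive (+-identityʳ _)) (penalty-≤-majFrom m s (x ∷ v))
  ... | true  | ofʸ f<x with f∈
  ...   | here refl = ⊥-elim (<-irrefl refl f<x)
  ...   | there f∈v with countGreater s (x ∷ v) | above | two-descents m s {f} {x} v
  ...     | zero  | _   | _ = ≤-trans (n≤1+n m) (one-descent m s v f<x f∈v)
  ...     | suc c | abv | two = ≤-trans (≤-reflexive (+-comm (m + suc c) m)) (two (abv (s≤s z≤n)) f<x f∈v)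

  -- The letter `g` closes the first factor and opens the second, so the descent at the seam is
  -- counted exactly once.
  majFrom-++ : ∀ i v g t → majFrom i (v ++ g ∷ t) ≡ majFrom i (v ++ [ g ]) + majFrom (i + length v) (g ∷ t)
  majFrom-++ i []          g t rewrite +-identityʳ i = refl
  majFrom-++ i (x ∷ [])    g t rewrite +-comm i 1 = cong (_+ majFrom (suc i) (g ∷ t)) (sym (+-identityʳ (if g <ᵇ x then i else 0)))
  majFrom-++ i (x ∷ y ∷ v) g t rewrite majFrom-++ (suc i) (y ∷ v) g t | +-suc i (length (y ∷ v)) =
    sym (+-assoc (if y <ᵇ x then i else 0) _ _)

  -- Only the comparison at index `m + length (x ∷ v)` can change. A descent gained there has its
  -- upper letter above `g` but not above `g′`, whence `g < g′`.
  majFrom-change-last : ∀ m x v g g′ → majFrom (suc m) (x ∷ v ++ [ g ]) ≤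
    majFrom (suc m) (x ∷ v ++ [ g′ ]) + (if g <ᵇ g′ then m + length (x ∷ v) else 0)
  majFrom-change-last m x (y ∷ v) g g′ rewrite +-suc m (length (y ∷ v))
    | +-assoc (if y <ᵇ x then suc m else 0) (majFrom (2 + m) (y ∷ v ++ [ g′ ])) (if g <ᵇ g′ then suc m + length (y ∷ v) else 0) =
    +-monoʳ-≤ (if y <ᵇ x then suc m else 0) (majFrom-change-last (suc m) y v g g′)
  majFrom-change-last m x [] g g′ with g <ᵇ x | <ᵇ-reflects-< g x
  ... | false | _ = z≤n
  ... | true  | ofʸ g<x with g <ᵇ g′ | <ᵇ-reflects-< g g′
  ...   | true  | _ rewrite +-comm m 1 | +-identityʳ m = m≤n+m (suc m) _
  ...   | false | ofⁿ g≮g′ with g′ <ᵇ x | <ᵇ-reflects-< g′ x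
  ...     | true  | _ = m≤m+n _ _
  ...     | false | ofⁿ g′≮x = ⊥-elim (g′≮x (≤-<-trans (≮⇒≥ g≮g′) g<x))

  ∈-insertions-↭ : ∀ x ys {v} → v ∈ insertions x ys → v ↭ x ∷ ys
  ∈-insertions-↭ x []       (here refl) = ↭-refl
  ∈-insertions-↭ x (y ∷ ys) (here refl) = ↭-refl
  ∈-insertions-↭ x (y ∷ ys) (there v∈) with ∈ₚ.∈-map⁻ (y ∷_) v∈
  ... | u , u∈ , refl = ↭-trans (prep y (∈-insertions-↭ x ys u∈)) (swap y x ↭-refl)

  ∈-perms-↭ : ∀ B {v} → v ∈ perms B → v ↭ B
  ∈-perms-↭ []      (here refl) = ↭-refl
  ∈-perms-↭ (x ∷ B) v∈ with ∈ₚ.∈-concatMap⁻ (insertions x) {xs = perms B} v∈ 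
  ... | any with find any
  ...   | u , u∈ , v∈′ = ↭-trans (∈-insertions-↭ x u v∈′) (prep x (∈-perms-↭ B u∈))

  insertion∈ : ∀ x p s → p ++ x ∷ s ∈ insertions x (p ++ s)
  insertion∈ x []      []      = here refl
  insertion∈ x []      (_ ∷ _) = here refl
  insertion∈ x (y ∷ p) s       = there (∈ₚ.∈-map⁺ (y ∷_) (insertion∈ x p s))

  rotate∈perms : ∀ s B → rotate s B ∈ perms B
  rotate∈perms s [] = here refl
  rotate∈perms s (x ∷ B) = ∈ₚ.∈-concatMap⁺ (insertions x) (lose (rotate∈perms s B) inserted)
    where
    inserted : rotate s (x ∷ B) ∈ insertions x (rotate s B)
    inserted with s <ᵇ x
    ... | true  = insertion∈ x [] (rotate s B)
    ... | false = insertion∈ x (hi s B) (lo s B)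

  ∈-words⁻ : ∀ B μ {w} → w ∈ words (B ∷ μ) → ∃₂ λ v w′ → v ↭ B × w′ ∈ words μ × w ≡ v ++ w′
  ∈-words⁻ B μ w∈ with find (∈ₚ.∈-concatMap⁻ (λ u → map (u ++_) (words μ)) {xs = perms B} w∈)
  ... | v , v∈ , w∈′ with ∈ₚ.∈-map⁻ (v ++_) w∈′
  ...   | w′ , w′∈ , refl = v , w′ , ∈-perms-↭ B v∈ , w′∈ , refl

  ∈-words-↭ : ∀ μ {w} → w ∈ words μ → w ↭ concat μ
  ∈-words-↭ []      (here refl) = ↭-refl
  ∈-words-↭ (B ∷ μ) w∈ with ∈-words⁻ B μ w∈
  ... | v , w′ , v↭B , w′∈ , refl = Permₚ.++⁺ v↭B (∈-words-↭ μ w′∈)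

  greedy∈words : ∀ μ r → greedy μ r ∈ words μ
  greedy∈words []      r = here refl
  greedy∈words (B ∷ μ) r = ∈ₚ.∈-concatMap⁺ (λ u → map (u ++_) (words μ))
    (lose (rotate∈perms (lead μ r) B) (∈ₚ.∈-map⁺ (rotate (lead μ r) B ++_) (greedy∈words μ r)))

  -- A word starting above the greedy first letter pays at least m more, which offsets
  -- the descent that it may avoid between the preceding block and its first letter.
  cost-≤-majFrom : ∀ m r μ {w} → All NonEmpty μ → w ∈ words μ →
    cost m μ r + (if lead μ r <ᵇ hd r w then m else 0) ≤ majFrom (suc m) (w ++ [ r ])
  cost-≤-majFrom m r [] [] (here refl) with r <ᵇ r | <ᵇ-reflects-< r r
  ... | false | _ = z≤n
  ... | true  | ofʸ r<r = ⊥-elim (<-irrefl refl r<r)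
  cost-≤-majFrom m r (B ∷ μ) (ne ∷ nes) w∈ with ∈-words⁻ B μ w∈
  ... | [] , w′ , v↭B , w′∈ , refl = ⊥-elim (ne (Permₚ.↭-empty-inv (↭-sym v↭B)))
  ... | x ∷ v , w′ , v↭B , w′∈ , refl
    rewrite Listₚ.++-assoc (x ∷ v) w′ [ r ] with ∷ʳ-hd r w′ | cost-≤-majFrom (m + length B) r μ nes w′∈
  ...   | t , eq | ih = begin
    pB + rest + e                         ≡⟨ cong (_+ e) (+-comm pB rest) ⟩
    rest + pB + e                         ≡⟨ +-assoc rest pB e ⟩
    rest + (pB + e)                       ≤⟨ +-monoʳ-≤ rest local ⟩
    rest + (majFrom (suc m) (x ∷ v ++ [ g′ ]) + j) ≡⟨ cong (rest +_) (+-comm _ j) ⟩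
    rest + (j + majFrom (suc m) (x ∷ v ++ [ g′ ])) ≡⟨ +-assoc rest j _ ⟨
    rest + j + majFrom (suc m) (x ∷ v ++ [ g′ ])   ≤⟨ +-monoˡ-≤ _ ih ⟩
    majFrom (suc (m + length B)) (w′ ++ [ r ]) + majFrom (suc m) (x ∷ v ++ [ g′ ])
      ≡⟨ +-comm _ (majFrom (suc m) (x ∷ v ++ [ g′ ])) ⟩
    majFrom (suc m) (x ∷ v ++ [ g′ ]) + majFrom (suc (m + length B)) (w′ ++ [ r ])
      ≡⟨ cong₂ (λ n l → majFrom (suc m) (x ∷ v ++ [ g′ ]) + majFrom (suc (m + n)) l) (sym len) eq ⟩
    majFrom (suc m) (x ∷ v ++ [ g′ ]) + majFrom (suc m + length (x ∷ v)) (g′ ∷ t) ≡⟨ majFrom-++ (suc m) (x ∷ v) g′ t ⟨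
    majFrom (suc m) (x ∷ v ++ g′ ∷ t)     ≡⟨ cong (λ l → majFrom (suc m) (x ∷ v ++ l)) eq ⟨
    majFrom (suc m) (x ∷ v ++ (w′ ++ [ r ])) ∎
    where
    open ≤-Reasoning
    g = lead μ r
    g′ = hd r w′
    pB = penalty m (countGreater g B)
    rest = cost (m + length B) μ r
    e = if first g B <ᵇ x then m else 0
    j = if g <ᵇ g′ then m + length B else 0
    len : length (x ∷ v) ≡ length B
    len = Permₚ.↭-length v↭B
    cg : countGreater g (x ∷ v) ≡ countGreater g B
    cg = countGreater-↭ g v↭B
    -- The block is first bounded as if the greedy letter `g` followed it. Passing to the actual
    -- next letter `g′` loses at most `j`, which is the surplus in the induction hypothesis.
    local : pB + e ≤ majFrom (suc m) (x ∷ v ++ [ g′ ]) + j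
    local = begin
      pB + e ≡⟨ cong (λ c → penalty m c + e) cg ⟨
      penalty m (countGreater g (x ∷ v)) + e
        ≤⟨ block-bound m g x v (Permₚ.∈-resp-↭ (↭-sym v↭B) (first∈ g ne))
             (λ pos → first-above g B (subst (0 <_) cg pos)) ⟩
      majFrom (suc m) (x ∷ v ++ [ g ]) ≤⟨ majFrom-change-last m x v g g′ ⟩
      majFrom (suc m) (x ∷ v ++ [ g′ ]) + (if g <ᵇ g′ then m + length (x ∷ v) else 0)
        ≡⟨ cong (λ n → majFrom (suc m) (x ∷ v ++ [ g′ ]) + (if g <ᵇ g′ then m + n else 0)) len ⟩
      majFrom (suc m) (x ∷ v ++ [ g′ ]) + j ∎

  majFrom-nondecreasing : ∀ i {l} → AllPairs _≤_ l → majFrom i l ≡ 0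
  majFrom-nondecreasing i []              = refl
  majFrom-nondecreasing i ([] ∷ [])       = refl
  majFrom-nondecreasing i {x ∷ y ∷ l} ((x≤y ∷ _) ∷ p) with y <ᵇ x | <ᵇ-reflects-< y x
  ... | false | _ = majFrom-nondecreasing (suc i) p
  ... | true  | ofʸ y<x = ⊥-elim (<⇒≱ y<x x≤y)

  -- Both runs increase and the second stays at most `s`, so the only descent is at the end of `h`,
  -- at index `m + length h`.
  majFrom-hi-lo : ∀ m s {h l} → Increasing h → All (s <_) h → Increasing l → All (_≤ s) l →
                  majFrom (suc m) (h ++ (l ++ [ s ])) ≡ penalty m (length h)
  majFrom-hi-lo m s {[]} {l} _ _ incl l≤s = majFrom-nondecreasing (suc m)
    (AllPairsₚ.++⁺ (AllPairs.map <⇒≤ incl) ([] ∷ []) (All.map (λ x≤s → x≤s ∷ []) l≤s))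
  majFrom-hi-lo m s {x ∷ []} {l} _ (s<x ∷ _) incl l≤s
    with l | ∷ʳ-hd s l | l≤s | majFrom-hi-lo (suc m) s {[]} {l} [] [] incl l≤s
  ... | [] | _ | _ | _ with s <ᵇ x | <ᵇ-reflects-< s x
  ...   | true  | _ = trans (+-identityʳ _) (+-comm 1 m)
  ...   | false | ofⁿ s≮x = ⊥-elim (s≮x s<x)
  majFrom-hi-lo m s {x ∷ []} _ (s<x ∷ _) incl l≤s
      | y ∷ _ | _ | y≤s ∷ _ | ih with y <ᵇ x | <ᵇ-reflects-< y x
  ...   | true  | _ rewrite ih = trans (+-identityʳ _) (+-comm 1 m)
  ...   | false | ofⁿ y≮x = ⊥-elim (y≮x (≤-<-trans y≤s s<x))
  majFrom-hi-lo m s {x ∷ y ∷ h} ((x<y ∷ _) ∷ inc) (_ ∷ s<h) incl l≤s with y <ᵇ x | <ᵇ-reflects-< y x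
  ... | true  | ofʸ y<x = ⊥-elim (<-asym x<y y<x)
  ... | false | _ = trans (majFrom-hi-lo (suc m) s inc s<h incl l≤s) (sym (+-suc m _))

  lo-≤ : ∀ s B → All (_≤ s) (lo s B)
  lo-≤ s B = All.map ≮⇒≥ (Allₚ.all-filter (λ x → ¬? (s <? x)) B)

  majFrom-rotate : ∀ m s {B} → Increasing B → majFrom (suc m) (rotate s B ++ [ s ]) ≡ penalty m (countGreater s B)
  majFrom-rotate m s {B} inc rewrite Listₚ.++-assoc (hi s B) (lo s B) [ s ] | countGreater-hi s B =
    majFrom-hi-lo m s (AllPairsₚ.filter⁺ (s <?_) inc) (Allₚ.all-filter (s <?_) B)
      (AllPairsₚ.filter⁺ (λ x → ¬? (s <? x)) inc) (lo-≤ s B)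

  majFrom-greedy : ∀ m μ r → All Increasing μ → majFrom (suc m) (greedy μ r ++ [ r ]) ≡ cost m μ r
  majFrom-greedy m []      r [] = refl
  majFrom-greedy m (B ∷ μ) r (inc ∷ incs) with ∷ʳ-hd r (greedy μ r)
  ... | t , eq = begin
    majFrom (suc m) ((R ++ greedy μ r) ++ [ r ]) ≡⟨ cong (majFrom (suc m)) (Listₚ.++-assoc R (greedy μ r) [ r ]) ⟩
    majFrom (suc m) (R ++ (greedy μ r ++ [ r ])) ≡⟨ cong (λ l → majFrom (suc m) (R ++ l)) eq′ ⟩
    majFrom (suc m) (R ++ g ∷ t)                 ≡⟨ majFrom-++ (suc m) R g t ⟩
    majFrom (suc m) (R ++ [ g ]) + majFrom (suc m + length R) (g ∷ t)
      ≡⟨ cong₂ _+_ (majFrom-rotate m g inc) (cong₂ (λ n l → majFrom (suc (m + n)) l) (Permₚ.↭-length (rotate-↭ g B)) (sym eq′)) ⟩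
    penalty m (countGreater g B) + majFrom (suc (m + length B)) (greedy μ r ++ [ r ])
      ≡⟨ cong (penalty m (countGreater g B) +_) (majFrom-greedy (m + length B) μ r incs) ⟩
    cost m (B ∷ μ) r ∎
    where
    open ≡-Reasoning
    g = lead μ r
    R = rotate g B
    eq′ : greedy μ r ++ [ r ] ≡ g ∷ t
    eq′ = trans eq (cong (_∷ t) (hd-greedy μ r))

  majFrom-∷ʳ-max : ∀ i {w n} → All (_≤ n) w → majFrom i (w ++ [ n ]) ≡ majFrom i w
  majFrom-∷ʳ-max i [] = refl
  majFrom-∷ʳ-max i {x ∷ []} {n} (x≤n ∷ []) with n <ᵇ x | <ᵇ-reflects-< n x
  ... | true  | ofʸ n<x = ⊥-elim (<⇒≱ n<x x≤n)
  ... | false | _ = refl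
  majFrom-∷ʳ-max i {x ∷ y ∷ w} (_ ∷ p) = cong ((if y <ᵇ x then i else 0) +_) (majFrom-∷ʳ-max (suc i) p)

  minimum-≤ : ∀ {x l} → x ∈ l → minimum l ≤ x
  minimum-≤ {l = x ∷ []}    (here refl) = ≤-refl
  minimum-≤ {l = x ∷ y ∷ l} (here refl) = m⊓n≤m x _
  minimum-≤ {l = y ∷ _ ∷ l} (there x∈)  = ≤-trans (m⊓n≤n y _) (minimum-≤ x∈)

  -- The member `x` excludes the empty list, whose `minimum` is 0 by default.
  ≤-minimum : ∀ {b x l} → x ∈ l → All (b ≤_) l → b ≤ minimum l
  ≤-minimum {l = x ∷ []}    _ (p ∷ _)  = p
  ≤-minimum {l = x ∷ y ∷ l} _ (p ∷ ps) = ⊓-glb p (≤-minimum (here refl) ps)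

  -- The sentinel `n` takes the place of the end letter `r`. The greedy word gives one inequality;
  -- the other is the lower bound for all words with its surplus dropped.
  minimaj-cost : ∀ n {μ} → All Increasing μ → All NonEmpty μ → All (_≤ n) (concat μ) → minimaj μ ≡ cost 0 μ n
  minimaj-cost n {μ} incs nes ≤n = ≤-antisym
    (subst (minimaj μ ≤_) (trans (maj-∷ʳ (greedy∈words μ n)) (majFrom-greedy 0 μ n incs)) (minimum-≤ maj-greedy∈))
    (≤-minimum maj-greedy∈ (Allₚ.map⁺ (All.tabulate bound)))
    where
    maj-greedy∈ : maj (greedy μ n) ∈ map maj (words μ)
    maj-greedy∈ = ∈ₚ.∈-map⁺ maj (greedy∈words μ n)
    maj-∷ʳ : ∀ {w} → w ∈ words μ → maj w ≡ majFrom 1 (w ++ [ n ])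
    maj-∷ʳ w∈ = sym (majFrom-∷ʳ-max 1 (Permₚ.All-resp-↭ (↭-sym (∈-words-↭ μ w∈)) ≤n))
    bound : ∀ {w} → w ∈ words μ → cost 0 μ n ≤ maj w
    bound w∈ = subst (cost 0 μ n ≤_) (sym (maj-∷ʳ w∈)) (≤-trans (m≤m+n _ _) (cost-≤-majFrom 0 n μ nes w∈))

open Minimaj

-- Enumeration by the last block.

blocks : List ℕ → List (List ℕ)
blocks []       = []
blocks (a ∷ as) = map (a ∷_) ([] ∷ blocks as) ++ blocks as

-- Blocks are appended on the right because both recursions remove the last block. The weight is
-- left free.
partitions : List ℕ → ℕ → List (List (List ℕ))
partitions L zero    = [ [] ]
partitions L (suc k) = cartesianProductWith (λ B μ → μ ∷ʳ B) (blocks L) (partitions L k)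

blocks-nonEmpty : ∀ as → All NonEmpty (blocks as)
blocks-nonEmpty []       = []
blocks-nonEmpty (a ∷ as) = Allₚ.++⁺ (Allₚ.map⁺ (All.universal (λ _ ()) _)) (blocks-nonEmpty as)

blocks-All : ∀ {p} {P : ℕ → Set p} {as} → All P as → All (All P) (blocks as)
blocks-All []         = []
blocks-All (pa ∷ pas) = Allₚ.++⁺ (Allₚ.map⁺ ((pa ∷ []) ∷ All.map (pa ∷_) (blocks-All pas))) (blocks-All pas)

concat-∷ʳ : ∀ (μ : List (List ℕ)) B → concat (μ ∷ʳ B) ≡ concat μ ++ B
concat-∷ʳ μ B = trans (sym (Listₚ.concat-++ μ [ B ])) (cong (concat μ ++_) (Listₚ.++-identityʳ B))

inv-∷ʳ : ∀ μ a B → inv (μ ∷ʳ (a ∷ B)) ≡ inv μ ℕ.+ countGreater a (concat μ)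
inv-∷ʳ μ a B = go [] μ
  where
  go : ∀ prev μ → invAux prev (μ ∷ʳ (a ∷ B)) ≡ invAux prev μ ℕ.+ countGreater a (prev ++ concat μ)
  go prev []            rewrite Listₚ.++-identityʳ prev = ℕₚ.+-identityʳ _
  go prev ([] ∷ μ)      = go prev μ
  go prev ((b ∷ C) ∷ μ) rewrite go (prev ++ b ∷ C) μ | Listₚ.++-assoc prev (b ∷ C) (concat μ) =
    sym (ℕₚ.+-assoc (countGreater b prev) _ _)

lead-∷ʳ : ∀ μ B r → lead (μ ∷ʳ B) r ≡ lead μ (first r B)
lead-∷ʳ []      B r = refl
lead-∷ʳ (C ∷ μ) B r = cong (λ g → first g C) (lead-∷ʳ μ B r)

-- The first letter of the removed block becomes the end letter of the rest. Its own penalty depends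
-- on the earlier blocks only through their number of letters.
cost-∷ʳ : ∀ m μ B r → cost m (μ ∷ʳ B) r ≡ cost m μ (first r B) ℕ.+ penalty (m ℕ.+ length (concat μ)) (countGreater r B)
cost-∷ʳ m []      B r = trans (ℕₚ.+-identityʳ _) (cong (λ n → penalty n (countGreater r B)) (sym (ℕₚ.+-identityʳ m)))
cost-∷ʳ m (C ∷ μ) B r rewrite lead-∷ʳ μ B r | cost-∷ʳ (m ℕ.+ length C) μ B r
  | Listₚ.length-++ C {concat μ} | ℕₚ.+-assoc m (length C) (length (concat μ)) =
  sym (ℕₚ.+-assoc (penalty m (countGreater (lead μ (first r B)) C)) _ _)

first-≤ : ∀ r B → countGreater r B ≡ 0 → first r B ≤ r
first-≤ r B eq rewrite countGreater-hi r B with hi r B | lo r B | lo-≤ r B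
... | [] | []    | _       = ≤-refl
... | [] | x ∷ _ | x≤r ∷ _ = x≤r

<ᵇ-true : ∀ {m n} → m < n → (m <ᵇ n) ≡ true
<ᵇ-true {m} {n} m<n with m <ᵇ n | <ᵇ-reflects-< m n
... | true  | _ = refl
... | false | ofⁿ m≮n = ⊥-elim (m≮n m<n)

<ᵇ-false : ∀ {m n} → n ≤ m → (m <ᵇ n) ≡ false
<ᵇ-false {m} {n} n≤m with m <ᵇ n | <ᵇ-reflects-< m n
... | false | _ = refl
... | true  | ofʸ m<n = ⊥-elim (<⇒≱ m<n n≤m)

-- The cyclic order of the letters in which the letter after r comes first and r comes last.
Before : ℕ → Rel ℕ _
Before r x y = (r < x × x < y) ⊎ (x < y × y ≤ r) ⊎ (y ≤ r × r < x)

rotate-Before : ∀ r {L} → Increasing L → AllPairs (Before r) (rotate r L)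
rotate-Before r {L} inc = AllPairsₚ.++⁺
  (his (Allₚ.all-filter (r <?_) L) (AllPairsₚ.filter⁺ (r <?_) inc))
  (los (lo-≤ r L) (AllPairsₚ.filter⁺ (λ x → ¬? (r <? x)) inc))
  (All.map (λ r<x → All.map (λ y≤r → inj₂ (inj₂ (y≤r , r<x))) (lo-≤ r L)) (Allₚ.all-filter (r <?_) L))
  where
  his : ∀ {l} → All (r <_) l → Increasing l → AllPairs (Before r) l
  his []        []         = []
  his (r<x ∷ a) (x<l ∷ i) = All.map (λ x<y → inj₁ (r<x , x<y)) x<l ∷ his a i
  los : ∀ {l} → All (_≤ r) l → Increasing l → AllPairs (Before r) l
  los []        []         = []
  los (_ ∷ a)   (x<l ∷ i) = All.zipWith (λ (x<y , y≤r) → inj₂ (inj₁ (x<y , y≤r))) (x<l , a) ∷ los a i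

lo++hi : ∀ r {L} → Increasing L → lo r L ++ hi r L ≡ L
lo++hi r [] = refl
lo++hi r {x ∷ L} (x<L ∷ inc) with r <ᵇ x | <ᵇ-reflects-< r x
... | false | _ = cong (x ∷_) (lo++hi r inc)
... | true  | ofʸ r<x = cong₂ _++_
  (Listₚ.filter-none (λ y → ¬? (r <? y)) (All.map (λ x<y r≮y → r≮y (<-trans r<x x<y)) x<L))
  (cong (x ∷_) (Listₚ.filter-all (r <?_) (All.map (<-trans r<x) x<L)))

AllPairs-around : ∀ {a ℓ} {A : Set a} {_∼_ : Rel A ℓ} u {x l} → AllPairs _∼_ (u ++ x ∷ l) →
                  All (_∼ x) u × All (x ∼_) l
AllPairs-around []      (x∼l ∷ _) = [] , x∼l
AllPairs-around (y ∷ u) (y∼ ∷ p) with Allₚ.++⁻ʳ u y∼ | AllPairs-around u p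
... | y∼x ∷ _ | before , after = (y∼x ∷ before) , after

-- Generating functions of both statistics.

module GeneratingFunctions {c ℓ : Level} (S : CommutativeSemiring c ℓ) (q : CommutativeSemiring.Carrier S) where
  open CommutativeSemiring S renaming (Carrier to R; refl to ≈-refl; sym to ≈-sym; trans to ≈-trans; reflexive to ≈-reflexive)
  open import Algebra.Properties.Semiring.Exp semiring using (_^_; ^-homo-*)
  open NatSolver S using (solve; _:=_; _:+_; _:*_; con)
  open import Relation.Binary.Reasoning.Setoid setoid
  open Symmetric S q

  ∑ : ∀ {a} {A : Set a} → (A → R) → List A → R
  ∑ g []      = 0#
  ∑ g (x ∷ l) = g x + ∑ g l

  ∑-++ : ∀ {a} {A : Set a} (g : A → R) l l′ → ∑ g (l ++ l′) ≈ ∑ g l + ∑ g l′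
  ∑-++ g []      l′ = ≈-sym (+-identityˡ _)
  ∑-++ g (x ∷ l) l′ = ≈-trans (+-congˡ (∑-++ g l l′)) (≈-sym (+-assoc _ _ _))

  ∑-map : ∀ {a b} {A : Set a} {B : Set b} (g : B → R) (f : A → B) l → ∑ g (map f l) ≈ ∑ (λ x → g (f x)) l
  ∑-map g f []      = ≈-refl
  ∑-map g f (x ∷ l) = +-congˡ (∑-map g f l)

  ∑-cong-All : ∀ {a} {A : Set a} {g g′ : A → R} {l} → All (λ x → g x ≈ g′ x) l → ∑ g l ≈ ∑ g′ l
  ∑-cong-All []       = ≈-refl
  ∑-cong-All (e ∷ es) = +-cong e (∑-cong-All es)

  ∑-cong : ∀ {a} {A : Set a} {g g′ : A → R} l → (∀ x → g x ≈ g′ x) → ∑ g l ≈ ∑ g′ l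
  ∑-cong l e = ∑-cong-All (All.universal e l)

  *-∑ : ∀ {a} {A : Set a} c (g : A → R) l → ∑ (λ x → c * g x) l ≈ c * ∑ g l
  *-∑ c g []      = ≈-sym (zeroʳ c)
  *-∑ c g (x ∷ l) = ≈-trans (+-congˡ (*-∑ c g l)) (≈-sym (distribˡ c _ _))

  ∑-* : ∀ {a} {A : Set a} c (g : A → R) l → ∑ (λ x → g x * c) l ≈ ∑ g l * c
  ∑-* c g l = ≈-trans (∑-cong l (λ x → *-comm _ c)) (≈-trans (*-∑ c g l) (*-comm c _))

  ∑-cartesianProductWith : ∀ {a} {A B C : Set a} (g : C → R) (f : A → B → C) xs ys →
    ∑ g (cartesianProductWith f xs ys) ≈ ∑ (λ x → ∑ (λ y → g (f x y)) ys) xs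
  ∑-cartesianProductWith g f []       ys = ≈-refl
  ∑-cartesianProductWith g f (x ∷ xs) ys = ≈-trans (∑-++ g (map (f x) ys) _)
    (+-cong (∑-map g (f x) ys) (∑-cartesianProductWith g f xs ys))

  weight : (ℕ → R) → List ℕ → R
  weight φ []       = 1#
  weight φ (x ∷ xs) = φ x * weight φ xs

  weight-++ : ∀ φ xs ys → weight φ (xs ++ ys) ≈ weight φ xs * weight φ ys
  weight-++ φ []       ys = ≈-sym (*-identityˡ _)
  weight-++ φ (x ∷ xs) ys = ≈-trans (*-congˡ (weight-++ φ xs ys)) (≈-sym (*-assoc _ _ _))

  raise : ℕ → (ℕ → R) → ℕ → R
  raise a φ x = if a <ᵇ x then q * φ x else φ x

  -- Counting letters above `a` thus becomes a change of variables, which keeps the sum over the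
  -- remaining blocks in its original form.
  weight-raise : ∀ a φ xs → weight (raise a φ) xs ≈ weight φ xs * q ^ countGreater a xs
  weight-raise a φ [] = ≈-sym (*-identityˡ _)
  weight-raise a φ (x ∷ xs) with a <ᵇ x
  ... | true  = ≈-trans (*-congˡ (weight-raise a φ xs))
    (solve 4 (λ q x w e → q :* x :* (w :* e) := x :* w :* (q :* e)) ≈-refl q (φ x) (weight φ xs) (q ^ countGreater a xs))
  ... | false = ≈-trans (*-congˡ (weight-raise a φ xs)) (≈-sym (*-assoc _ _ _))

  weight-scale : ∀ φ xs → weight (λ x → q * φ x) xs ≈ weight φ xs * q ^ length xs
  weight-scale φ []       = ≈-sym (*-identityˡ _)
  weight-scale φ (x ∷ xs) = ≈-trans (*-congˡ (weight-scale φ xs))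
    (solve 4 (λ q x w e → q :* x :* (w :* e) := x :* w :* (q :* e)) ≈-refl q (φ x) (weight φ xs) (q ^ length xs))

  ∑-blocks : ∀ φ as → 1# + ∑ (weight φ) (blocks as) ≈ ∏1+ (map φ as)
  ∑-blocks φ []       = +-identityʳ _
  ∑-blocks φ (a ∷ as) = begin
    1# + ∑ (weight φ) (map (a ∷_) ([] ∷ blocks as) ++ blocks as)
      ≈⟨ +-congˡ (≈-trans (∑-++ (weight φ) (map (a ∷_) ([] ∷ blocks as)) _) (+-congʳ (≈-trans (∑-map (weight φ) (a ∷_) ([] ∷ blocks as)) (*-∑ (φ a) (weight φ) ([] ∷ blocks as))))) ⟩
    1# + (φ a * (1# + b) + b)
      ≈⟨ solve 2 (λ v b → con 1 :+ (v :* (con 1 :+ b) :+ b) := (con 1 :+ v) :* (con 1 :+ b)) ≈-refl (φ a) b ⟩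
    (1# + φ a) * (1# + b)
      ≈⟨ *-congˡ (∑-blocks φ as) ⟩
    ∏1+ (map φ (a ∷ as)) ∎
    where b = ∑ (weight φ) (blocks as)

  -- A form of `gsum` whose continuation sees the chosen letter itself: raising weights compares
  -- letters, and a letter cannot be recovered from its weight.
  bsum : (ℕ → R) → (ℕ → R) → List ℕ → R
  bsum φ F []       = 0#
  bsum φ F (a ∷ as) = φ a * ∏1+ (map φ as) * F a + bsum φ F as

  ∑-blocks-hd : ∀ φ F r as → ∑ (λ B → weight φ B * F (hd r B)) (blocks as) ≈ bsum φ F as
  ∑-blocks-hd φ F r []       = ≈-refl
  ∑-blocks-hd φ F r (a ∷ as) = ≈-trans (∑-++ g (map (a ∷_) ([] ∷ blocks as)) _) (+-cong starting (∑-blocks-hd φ F r as))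
    where
    g = λ B → weight φ B * F (hd r B)
    starting : ∑ g (map (a ∷_) ([] ∷ blocks as)) ≈ φ a * ∏1+ (map φ as) * F a
    starting = begin
      ∑ g (map (a ∷_) ([] ∷ blocks as))                       ≈⟨ ∑-map g (a ∷_) ([] ∷ blocks as) ⟩
      ∑ (λ B → φ a * weight φ B * F a) ([] ∷ blocks as)       ≈⟨ ∑-* (F a) (λ B → φ a * weight φ B) ([] ∷ blocks as) ⟩
      ∑ (λ B → φ a * weight φ B) ([] ∷ blocks as) * F a       ≈⟨ *-congʳ (*-∑ (φ a) (weight φ) ([] ∷ blocks as)) ⟩
      φ a * (1# + ∑ (weight φ) (blocks as)) * F a             ≈⟨ *-congʳ (*-congˡ (∑-blocks φ as)) ⟩
      φ a * ∏1+ (map φ as) * F a                              ∎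

  bsum-++ : ∀ φ F xs ys → bsum φ F (xs ++ ys) ≈ bsum φ F xs * ∏1+ (map φ ys) + bsum φ F ys
  bsum-++ φ F []       ys = ≈-sym (≈-trans (+-congʳ (zeroˡ _)) (+-identityˡ _))
  bsum-++ φ F (x ∷ xs) ys = begin
    φ x * ∏1+ (map φ (xs ++ ys)) * F x + bsum φ F (xs ++ ys)
      ≈⟨ +-cong (*-congʳ (*-congˡ (≈-trans (≈-reflexive (cong ∏1+ (Listₚ.map-++ φ xs ys))) (∏1+-++ (map φ xs) (map φ ys))))) (bsum-++ φ F xs ys) ⟩
    φ x * (P * Q) * F x + (bsum φ F xs * Q + bsum φ F ys)
      ≈⟨ solve 6 (λ x P Q F b c → x :* (P :* Q) :* F :+ (b :* Q :+ c) := (x :* P :* F :+ b) :* Q :+ c) ≈-refl (φ x) P Q (F x) (bsum φ F xs) (bsum φ F ys) ⟩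
    (φ x * P * F x + bsum φ F xs) * Q + bsum φ F ys ∎
    where
    P = ∏1+ (map φ xs)
    Q = ∏1+ (map φ ys)

  -- The hypothesis runs over all splittings of the list because `gsum` moves the letters before the
  -- chosen one into `H`.
  bsum≈gsum : ∀ φ F H as →
    (∀ u a l → as ≡ u ++ a ∷ l → F a ≈ H (map φ u ++ φ a ∷ map (q *_) (map φ l))) →
    bsum φ F as ≈ gsum H (map φ as)
  bsum≈gsum φ F H []       e = ≈-refl
  bsum≈gsum φ F H (a ∷ as) e = +-cong (*-congˡ (e [] a as refl))
    (bsum≈gsum φ F (λ l → H (φ a ∷ l)) as (λ u b l eq → e (a ∷ u) b l (cong (a ∷_) eq)))

  -- If B has letters > r, then first r B is the least of them and the letters ≤ r contribute
  -- a free factor: the blocks are summed as if the alphabet had the cyclic order ys ++ xs.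
  ∑-blocks-first : ∀ φ F r xs ys → All (_≤ r) xs → All (r <_) ys →
    ∑ (λ B → weight φ B * F (first r B)) (blocks (xs ++ ys)) ≈ bsum φ F (ys ++ xs)
  ∑-blocks-first φ F r xs ys xs≤r r<ys = ≈-trans (main xs xs≤r) (≈-sym (bsum-++ φ F ys xs))
    where
    above : ∀ d → ∑ (λ B → weight φ B * F (hd d (hi r B))) (blocks ys) ≈ bsum φ F ys
    above d = ≈-trans
      (∑-cong-All (All.map (λ {B} r<B → *-congˡ (≈-reflexive (cong (λ l → F (hd d l)) (Listₚ.filter-all (r <?_) r<B)))) (blocks-All r<ys)))
      (∑-blocks-hd φ F d ys)

    hi-≤ : ∀ {x} B → x ≤ r → hi r (x ∷ B) ≡ hi r B
    hi-≤ B x≤r = Listₚ.filter-reject (r <?_) (≤⇒≯ x≤r)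

    first-∷ : ∀ {x} B → x ≤ r → first r (x ∷ B) ≡ hd x (hi r B)
    first-∷ {x} B x≤r rewrite hi-≤ B x≤r | Listₚ.filter-accept (λ y → ¬? (r <? y)) {x} {B} (≤⇒≯ x≤r) with hi r B
    ... | []    = refl
    ... | _ ∷ _ = refl

    -- Here `d` is the first letter at most `r` already chosen. It leads the rotated block exactly
    -- when no letter above `r` is taken, which gives `F d`; the remaining low letters are chosen
    -- freely.
    subsets : ∀ d xs → All (_≤ r) xs →
      ∑ (λ B → weight φ B * F (hd d (hi r B))) ([] ∷ blocks (xs ++ ys)) ≈ ∏1+ (map φ xs) * (F d + bsum φ F ys)
    subsets d [] [] = begin
      1# * F d + ∑ _ (blocks ys)  ≈⟨ +-cong (*-identityˡ _) (above d) ⟩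
      F d + bsum φ F ys           ≈⟨ *-identityˡ _ ⟨
      1# * (F d + bsum φ F ys)    ∎
    subsets d (x ∷ xs) (x≤r ∷ xs≤r) = begin
      g [] + ∑ g (map (x ∷_) ([] ∷ blocks (xs ++ ys)) ++ blocks (xs ++ ys))
        ≈⟨ +-congˡ (≈-trans (∑-++ g (map (x ∷_) ([] ∷ blocks (xs ++ ys))) _) (+-congʳ (∑-map g (x ∷_) ([] ∷ blocks (xs ++ ys))))) ⟩
      g [] + (∑ (λ B → g (x ∷ B)) ([] ∷ blocks (xs ++ ys)) + ∑ g (blocks (xs ++ ys)))
        ≈⟨ +-congˡ (+-congʳ (≈-trans (∑-cong ([] ∷ blocks (xs ++ ys)) with-x) (*-∑ (φ x) g ([] ∷ blocks (xs ++ ys))))) ⟩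
      g [] + (φ x * (g [] + b) + b)
        ≈⟨ solve 3 (λ g v b → g :+ (v :* (g :+ b) :+ b) := (con 1 :+ v) :* (g :+ b)) ≈-refl (g []) (φ x) b ⟩
      (1# + φ x) * (g [] + b)
        ≈⟨ *-congˡ (subsets d xs xs≤r) ⟩
      (1# + φ x) * (∏1+ (map φ xs) * (F d + bsum φ F ys))
        ≈⟨ *-assoc _ _ _ ⟨
      ∏1+ (map φ (x ∷ xs)) * (F d + bsum φ F ys) ∎
      where
      g = λ B → weight φ B * F (hd d (hi r B))
      b = ∑ g (blocks (xs ++ ys))
      with-x : ∀ B → g (x ∷ B) ≈ φ x * g B
      with-x B = ≈-trans (*-congˡ (≈-reflexive (cong (λ l → F (hd d l)) (hi-≤ B x≤r)))) (*-assoc _ _ _)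

    main : ∀ xs → All (_≤ r) xs →
      ∑ (λ B → weight φ B * F (first r B)) (blocks (xs ++ ys)) ≈ bsum φ F ys * ∏1+ (map φ xs) + bsum φ F xs
    main [] [] = begin
      ∑ (λ B → weight φ B * F (first r B)) (blocks ys)
        ≈⟨ ∑-cong-All (All.map (λ {B} r<B → *-congˡ (≈-reflexive (cong F (first-above-all B r<B)))) (blocks-All r<ys)) ⟩
      ∑ (λ B → weight φ B * F (hd r (hi r B))) (blocks ys) ≈⟨ above r ⟩
      bsum φ F ys                                          ≈⟨ ≈-trans (+-identityʳ _) (*-identityʳ _) ⟨
      bsum φ F ys * 1# + 0#                                ∎
      where
      first-above-all : ∀ B → All (r <_) B → first r B ≡ hd r (hi r B)
      first-above-all B r<B rewrite Listₚ.filter-none (λ y → ¬? (r <? y)) (All.map (λ r<y r≮y → r≮y r<y) r<B)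
        | Listₚ.++-identityʳ (hi r B) = refl
    main (x ∷ xs) (x≤r ∷ xs≤r) = begin
      ∑ g (map (x ∷_) ([] ∷ blocks (xs ++ ys)) ++ blocks (xs ++ ys))
        ≈⟨ ≈-trans (∑-++ g (map (x ∷_) ([] ∷ blocks (xs ++ ys))) _) (+-congʳ (∑-map g (x ∷_) ([] ∷ blocks (xs ++ ys)))) ⟩
      ∑ (λ B → g (x ∷ B)) ([] ∷ blocks (xs ++ ys)) + ∑ g (blocks (xs ++ ys))
        ≈⟨ +-cong (≈-trans (∑-cong ([] ∷ blocks (xs ++ ys)) with-x)
                     (≈-trans (*-∑ (φ x) _ ([] ∷ blocks (xs ++ ys))) (*-congˡ (subsets x xs xs≤r))))
                  (main xs xs≤r) ⟩
      φ x * (P * (F x + Y)) + (Y * P + X)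
        ≈⟨ solve 5 (λ v P F Y X → v :* (P :* (F :+ Y)) :+ (Y :* P :+ X) :=
                                  Y :* ((con 1 :+ v) :* P) :+ (v :* P :* F :+ X)) ≈-refl (φ x) P (F x) Y X ⟩
      Y * ((1# + φ x) * P) + (φ x * P * F x + X) ∎
      where
      g = λ B → weight φ B * F (first r B)
      P = ∏1+ (map φ xs)
      Y = bsum φ F ys
      X = bsum φ F xs
      with-x : ∀ B → g (x ∷ B) ≈ φ x * (weight φ B * F (hd x (hi r B)))
      with-x B = ≈-trans (*-congˡ (≈-reflexive (cong F (first-∷ B x≤r)))) (*-assoc _ _ _)

  map-Pointwise : ∀ {χ ψ : ℕ → R} {l} → All (λ x → χ x ≈ ψ x) l → Pointwise _≈_ (map χ l) (map ψ l)
  map-Pointwise []       = []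
  map-Pointwise (e ∷ es) = e ∷ map-Pointwise es

  G-around : ∀ k {χ φ} u {a} l → All (λ x → χ x ≈ φ x) u → χ a ≈ φ a → All (λ x → χ x ≈ q * φ x) l →
    G k (map χ (u ++ a ∷ l)) ≈ G k (map φ u ++ φ a ∷ map (q *_) (map φ l))
  G-around k {χ} {φ} u {a} l eu ea el
    rewrite Listₚ.map-++ χ u (a ∷ l) | sym (Listₚ.map-∘ {g = q *_} {f = φ} l) =
    Exchangeable.congr (G-exchangeable k) (PW.++⁺ (map-Pointwise eu) (ea ∷ map-Pointwise el))

  G-↭ : ∀ k (φ : ℕ → R) {l l′} → l ↭ l′ → G k (map φ l) ≈ G k (map φ l′)
  G-↭ k φ e = exchangeable-↭ (G-exchangeable k) (Permₚ.map⁺ φ e)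

  -- All `φ` are needed at once: a last block with minimum `a` leaves the sum for `raise a φ`. As
  -- `L` increases, this multiplies by `q` exactly the variables after that of `a`.
  inv-GF : ∀ L → Increasing L → ∀ k φ →
    ∑ (λ μ → weight φ (concat μ) * q ^ inv μ) (partitions L k) ≈ G k (map φ L)
  inv-GF L inc zero    φ = ≈-trans (+-identityʳ _) (*-identityˡ _)
  inv-GF L inc (suc k) φ = begin
    ∑ g (partitions L (suc k))
      ≈⟨ ∑-cartesianProductWith g (λ B μ → μ ∷ʳ B) (blocks L) (partitions L k) ⟩
    ∑ (λ B → ∑ (λ μ → g (μ ∷ʳ B)) (partitions L k)) (blocks L)
      ≈⟨ ∑-cong-All (All.map last-block (blocks-nonEmpty L)) ⟩
    ∑ (λ B → weight φ B * F (hd 0 B)) (blocks L)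
      ≈⟨ ∑-blocks-hd φ F 0 L ⟩
    bsum φ F L
      ≈⟨ bsum≈gsum φ F (G k) L around ⟩
    G (suc k) (map φ L) ∎
    where
    g = λ μ → weight φ (concat μ) * q ^ inv μ
    F = λ a → G k (map (raise a φ) L)
    last-block : ∀ {B} → NonEmpty B → ∑ (λ μ → g (μ ∷ʳ B)) (partitions L k) ≈ weight φ B * F (hd 0 B)
    last-block {[]}    ne = ⊥-elim (ne refl)
    last-block {a ∷ B} _  = begin
      ∑ (λ μ → g (μ ∷ʳ (a ∷ B))) (partitions L k)
        ≈⟨ ∑-cong (partitions L k) term ⟩
      ∑ (λ μ → weight φ (a ∷ B) * (weight (raise a φ) (concat μ) * q ^ inv μ)) (partitions L k)
        ≈⟨ *-∑ (weight φ (a ∷ B)) _ (partitions L k) ⟩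
      weight φ (a ∷ B) * ∑ (λ μ → weight (raise a φ) (concat μ) * q ^ inv μ) (partitions L k)
        ≈⟨ *-congˡ (inv-GF L inc k (raise a φ)) ⟩
      weight φ (a ∷ B) * F a ∎
      where
      term : ∀ μ → g (μ ∷ʳ (a ∷ B)) ≈ weight φ (a ∷ B) * (weight (raise a φ) (concat μ) * q ^ inv μ)
      term μ = begin
        g (μ ∷ʳ (a ∷ B))
          ≈⟨ *-cong (≈-trans (≈-reflexive (cong (weight φ) (concat-∷ʳ μ (a ∷ B)))) (weight-++ φ (concat μ) (a ∷ B)))
                    (≈-trans (≈-reflexive (cong (q ^_) (inv-∷ʳ μ a B))) (^-homo-* q (inv μ) _)) ⟩
        weight φ (concat μ) * weight φ (a ∷ B) * (q ^ inv μ * q ^ countGreater a (concat μ))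
          ≈⟨ solve 4 (λ w b i c → w :* b :* (i :* c) := b :* ((w :* c) :* i)) ≈-refl _ _ _ _ ⟩
        weight φ (a ∷ B) * ((weight φ (concat μ) * q ^ countGreater a (concat μ)) * q ^ inv μ)
          ≈⟨ *-congˡ (*-congʳ (weight-raise a φ (concat μ))) ⟨
        weight φ (a ∷ B) * (weight (raise a φ) (concat μ) * q ^ inv μ) ∎
    around : ∀ u a l → L ≡ u ++ a ∷ l → F a ≈ G k (map φ u ++ φ a ∷ map (q *_) (map φ l))
    around u a l refl with AllPairs-around u inc
    ... | u<a , a<l = G-around k u l
      (All.map (λ x<a → low (<⇒≤ x<a)) u<a) (low ≤-refl)
      (All.map (λ {x} a<x → ≈-reflexive (cong (λ b → if b then q * φ x else φ x) (<ᵇ-true a<x))) a<l)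
      where
      low : ∀ {x} → x ≤ a → raise a φ x ≈ φ x
      low {x} x≤a = ≈-reflexive (cong (λ b → if b then q * φ x else φ x) (<ᵇ-false x≤a))

  -- The end letter acts only through a factor `q` on the letters above it. The recursion runs in
  -- the cyclic order, the induction hypothesis along `L`, so symmetry is used twice: to reorder the
  -- argument of `F`, and to return to `L`.
  cost-GF : ∀ L → Increasing L → ∀ k r φ →
    ∑ (λ μ → weight φ (concat μ) * q ^ cost 0 μ r) (partitions L k) ≈ G k (map (raise r φ) L)
  cost-GF L inc zero    r φ = ≈-trans (+-identityʳ _) (*-identityˡ _)
  cost-GF L inc (suc k) r φ = begin
    ∑ g (partitions L (suc k))
      ≈⟨ ∑-cartesianProductWith g (λ B μ → μ ∷ʳ B) (blocks L) (partitions L k) ⟩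
    ∑ (λ B → ∑ (λ μ → g (μ ∷ʳ B)) (partitions L k)) (blocks L)
      ≈⟨ ∑-cong (blocks L) last-block ⟩
    ∑ (λ B → weight ψ B * F (first r B)) (blocks L)
      ≈⟨ ≈-reflexive (cong (λ l → ∑ (λ B → weight ψ B * F (first r B)) (blocks l)) (lo++hi r inc)) ⟨
    ∑ (λ B → weight ψ B * F (first r B)) (blocks (lo r L ++ hi r L))
      ≈⟨ ∑-blocks-first ψ F r (lo r L) (hi r L) (lo-≤ r L) (Allₚ.all-filter (r <?_) L) ⟩
    bsum ψ F (rotate r L)
      ≈⟨ bsum≈gsum ψ F (G k) (rotate r L) around ⟩
    G (suc k) (map ψ (rotate r L))
      ≈⟨ G-↭ (suc k) ψ (rotate-↭ r L) ⟩
    G (suc k) (map ψ L) ∎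
    where
    g = λ μ → weight φ (concat μ) * q ^ cost 0 μ r
    ψ = raise r φ
    -- A last block beginning with a letter a > r contains a descent or is followed by one,
    -- which adds 1 to the statistic for every earlier letter.
    boost : ℕ → ℕ → R
    boost a x = if r <ᵇ a then q * φ x else φ x
    F = λ a → G k (map (raise a (boost a)) L)
    last-block : ∀ B → ∑ (λ μ → g (μ ∷ʳ B)) (partitions L k) ≈ weight ψ B * F (first r B)
    last-block B = begin
      ∑ (λ μ → g (μ ∷ʳ B)) (partitions L k)
        ≈⟨ ∑-cong (partitions L k) term ⟩
      ∑ (λ μ → weight ψ B * (weight (boost f) (concat μ) * q ^ cost 0 μ f)) (partitions L k)
        ≈⟨ *-∑ (weight ψ B) _ (partitions L k) ⟩
      weight ψ B * ∑ (λ μ → weight (boost f) (concat μ) * q ^ cost 0 μ f) (partitions L k)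
        ≈⟨ *-congˡ (cost-GF L inc k f (boost f)) ⟩
      weight ψ B * F f ∎
      where
      f = first r B
      -- Of the penalty `m + c`, the part `c` falls on the letters of `B` above `r`, turning `φ`
      -- into `ψ`; the part `m` falls on the earlier letters.
      boosted : ∀ xs → weight φ xs * weight φ B * q ^ penalty (length xs) (countGreater r B) ≈
                       weight ψ B * weight (boost f) xs
      boosted xs with countGreater r B | first-≤ r B | first-above r B | weight-raise r φ B
      ... | zero  | f≤r | _   | e rewrite <ᵇ-false (f≤r refl) = begin
        weight φ xs * weight φ B * 1#   ≈⟨ *-assoc _ _ _ ⟩
        weight φ xs * (weight φ B * 1#) ≈⟨ *-comm _ _ ⟩
        weight φ B * 1# * weight φ xs   ≈⟨ *-congʳ e ⟨
        weight ψ B * weight φ xs        ∎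
      ... | suc n | _   | r<f | e rewrite <ᵇ-true (r<f (s≤s z≤n)) = begin
        weight φ xs * weight φ B * q ^ (length xs ℕ.+ suc n)
          ≈⟨ *-congˡ (^-homo-* q (length xs) (suc n)) ⟩
        weight φ xs * weight φ B * (q ^ length xs * q ^ suc n)
          ≈⟨ solve 4 (λ x b l n → x :* b :* (l :* n) := b :* n :* (x :* l)) ≈-refl _ _ _ _ ⟩
        weight φ B * q ^ suc n * (weight φ xs * q ^ length xs)
          ≈⟨ *-cong e (weight-scale φ xs) ⟨
        weight ψ B * weight (λ x → q * φ x) xs ∎
      term : ∀ μ → g (μ ∷ʳ B) ≈ weight ψ B * (weight (boost f) (concat μ) * q ^ cost 0 μ f)
      term μ = begin
        g (μ ∷ʳ B)
          ≈⟨ *-cong (≈-trans (≈-reflexive (cong (weight φ) (concat-∷ʳ μ B))) (weight-++ φ (concat μ) B))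
                    (≈-trans (≈-reflexive (cong (q ^_) (cost-∷ʳ 0 μ B r))) (^-homo-* q (cost 0 μ f) _)) ⟩
        weight φ (concat μ) * weight φ B * (q ^ cost 0 μ f * q ^ penalty (length (concat μ)) (countGreater r B))
          ≈⟨ solve 4 (λ w b i c → w :* b :* (i :* c) := w :* b :* c :* i) ≈-refl _ _ _ _ ⟩
        weight φ (concat μ) * weight φ B * q ^ penalty (length (concat μ)) (countGreater r B) * q ^ cost 0 μ f
          ≈⟨ *-congʳ (boosted (concat μ)) ⟩
        weight ψ B * weight (boost f) (concat μ) * q ^ cost 0 μ f
          ≈⟨ *-assoc _ _ _ ⟩
        weight ψ B * (weight (boost f) (concat μ) * q ^ cost 0 μ f) ∎
    -- Relative to `ψ`, letters after `a` in the cyclic order gain one factor `q` and the others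
    -- none. If `r < a`, `boost` cancels against `ψ` for letters above `r` and supplies the factor
    -- for the rest; if `a ≤ r`, `raise a` does both.
    around : ∀ u a l → rotate r L ≡ u ++ a ∷ l → F a ≈ G k (map ψ u ++ ψ a ∷ map (q *_) (map ψ l))
    around u a l eq with AllPairs-around u (subst (AllPairs (Before r)) eq (rotate-Before r inc))
    ... | before , after = begin
      F a                                          ≈⟨ G-↭ k (raise a (boost a)) (↭-sym (rotate-↭ r L)) ⟩
      G k (map (raise a (boost a)) (rotate r L))   ≈⟨ ≈-reflexive (cong (λ l → G k (map (raise a (boost a)) l)) eq) ⟩
      G k (map (raise a (boost a)) (u ++ a ∷ l))   ≈⟨ G-around k u l (All.map earlier before) self (All.map later after) ⟩
      _ ∎
      where
      self : raise a (boost a) a ≈ ψ a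
      self rewrite <ᵇ-false (≤-refl {a}) = ≈-refl
      earlier : ∀ {x} → Before r x a → raise a (boost a) x ≈ ψ x
      earlier (inj₁ (r<x , x<a))
        rewrite <ᵇ-false (<⇒≤ x<a) | <ᵇ-true (<-trans r<x x<a) | <ᵇ-true r<x = ≈-refl
      earlier (inj₂ (inj₁ (x<a , a≤r)))
        rewrite <ᵇ-false (<⇒≤ x<a) | <ᵇ-false a≤r | <ᵇ-false (<⇒≤ (<-≤-trans x<a a≤r)) = ≈-refl
      earlier (inj₂ (inj₂ (a≤r , r<x)))
        rewrite <ᵇ-true (≤-<-trans a≤r r<x) | <ᵇ-false a≤r | <ᵇ-true r<x = ≈-refl
      later : ∀ {x} → Before r a x → raise a (boost a) x ≈ q * ψ x
      later (inj₁ (r<a , a<x))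
        rewrite <ᵇ-true a<x | <ᵇ-true r<a | <ᵇ-true (<-trans r<a a<x) = ≈-refl
      later (inj₂ (inj₁ (a<x , x≤r)))
        rewrite <ᵇ-true a<x | <ᵇ-false (<⇒≤ (<-≤-trans a<x x≤r)) | <ᵇ-false x≤r = ≈-refl
      later (inj₂ (inj₂ (x≤r , r<a)))
        rewrite <ᵇ-false (<⇒≤ (≤-<-trans x≤r r<a)) | <ᵇ-true r<a | <ᵇ-false x≤r = ≈-refl

  -- No letter of `L` exceeds `n`, so `raise n φ` agrees with `φ` there and both sums are `G k` at
  -- the same point.
  inv-cost-GF : ∀ {n L} → Increasing L → All (_≤ n) L → ∀ k φ →
    ∑ (λ μ → weight φ (concat μ) * q ^ inv μ) (partitions L k) ≈
    ∑ (λ μ → weight φ (concat μ) * q ^ cost 0 μ n) (partitions L k)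
  inv-cost-GF {n} {L} inc L≤n k φ = begin
    ∑ (λ μ → weight φ (concat μ) * q ^ inv μ) (partitions L k)      ≈⟨ inv-GF L inc k φ ⟩
    G k (map φ L)
      ≈⟨ Exchangeable.congr (G-exchangeable k) (map-Pointwise (All.map (λ {x} x≤n → ≈-reflexive (cong (λ b → if b then q * φ x else φ x) (<ᵇ-false x≤n))) L≤n)) ⟨
    G k (map (raise n φ) L)                                         ≈⟨ cost-GF L inc k n φ ⟨
    ∑ (λ μ → weight φ (concat μ) * q ^ cost 0 μ n) (partitions L k) ∎

-- Polynomials with coefficients in ℕ and exponents in M: formal sums of monomials, identified when
-- every function on monomials has the same total over both.
module FormalSums {M : Set} (_∙_ : M → M → M) (ε : M) (isCM : IsCommutativeMonoid _≡_ _∙_ ε) where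
  open IsCommutativeMonoid isCM using (assoc; comm; identityˡ)

  total : (M → ℕ) → List M → ℕ
  total f []      = 0
  total f (m ∷ p) = f m ℕ.+ total f p

  record _≈_ (p r : List M) : Set where
    constructor ⟨_⟩
    field at : ∀ f → total f p ≡ total f r
  open _≈_

  _⊗_ : List M → List M → List M
  _⊗_ = cartesianProductWith _∙_

  total-++ : ∀ f p r → total f (p ++ r) ≡ total f p ℕ.+ total f r
  total-++ f []      r = refl
  total-++ f (m ∷ p) r = trans (cong (f m ℕ.+_) (total-++ f p r)) (sym (ℕₚ.+-assoc (f m) _ _))

  total-cong : ∀ {f g} → (∀ m → f m ≡ g m) → ∀ p → total f p ≡ total g p
  total-cong e []      = refl
  total-cong e (m ∷ p) = cong₂ ℕ._+_ (e m) (total-cong e p)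

  total-map : ∀ f (g : M → M) p → total f (map g p) ≡ total (λ m → f (g m)) p
  total-map f g []      = refl
  total-map f g (m ∷ p) = cong (f (g m) ℕ.+_) (total-map f g p)

  -- This reduces the laws of multiplication to identities between iterated finite sums.
  total-⊗ : ∀ f p r → total f (p ⊗ r) ≡ total (λ m → total (λ n → f (m ∙ n)) r) p
  total-⊗ f []      r = refl
  total-⊗ f (m ∷ p) r = trans (total-++ f (map (m ∙_) r) _) (cong₂ ℕ._+_ (total-map f (m ∙_) r) (total-⊗ f p r))

  total-+ : ∀ f g p → total (λ m → f m ℕ.+ g m) p ≡ total f p ℕ.+ total g p
  total-+ f g []      = refl
  total-+ f g (m ∷ p) = trans (cong (f m ℕ.+ g m ℕ.+_) (total-+ f g p)) (interchange (f m) (g m) _ _)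
    where open import Algebra.Properties.CommutativeSemigroup ℕₚ.+-commutativeSemigroup using (interchange)

  total-0 : ∀ p → total (λ _ → 0) p ≡ 0
  total-0 []      = refl
  total-0 (m ∷ p) = total-0 p

  total-swap : ∀ (h : M → M → ℕ) p r → total (λ m → total (h m) r) p ≡ total (λ n → total (λ m → h m n) p) r
  total-swap h []      r = sym (total-0 r)
  total-swap h (m ∷ p) r = trans (cong (total (h m) r ℕ.+_) (total-swap h p r)) (sym (total-+ (h m) _ r))

  ≈-isEquivalence : IsEquivalence _≈_
  ≈-isEquivalence = record
    { refl  = ⟨ (λ f → refl) ⟩
    ; sym   = λ e → ⟨ (λ f → sym (at e f)) ⟩
    ; trans = λ e e′ → ⟨ (λ f → trans (at e f) (at e′ f)) ⟩
    }

  ++-isCommutativeMonoid : IsCommutativeMonoid _≈_ _++_ []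
  ++-isCommutativeMonoid = record
    { isMonoid = record
      { isSemigroup = record
        { isMagma = record
          { isEquivalence = ≈-isEquivalence
          ; ∙-cong = λ {p} {p′} {r} {r′} e e′ → ⟨ (λ f →
              trans (total-++ f p r) (trans (cong₂ ℕ._+_ (at e f) (at e′ f)) (sym (total-++ f p′ r′)))) ⟩
          }
        ; assoc = λ p r s → ⟨ (λ f → cong (total f) (Listₚ.++-assoc p r s)) ⟩
        }
      ; identity = (λ p → ⟨ (λ f → refl) ⟩) , (λ p → ⟨ (λ f → cong (total f) (Listₚ.++-identityʳ p)) ⟩)
      }
    ; comm = λ p r → ⟨ (λ f → trans (total-++ f p r) (trans (ℕₚ.+-comm (total f p) _) (sym (total-++ f r p)))) ⟩
    }

  ⊗-comm : ∀ p r → (p ⊗ r) ≈ (r ⊗ p)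
  ⊗-comm p r = ⟨ (λ f → begin
    total f (p ⊗ r)                                ≡⟨ total-⊗ f p r ⟩
    total (λ m → total (λ n → f (m ∙ n)) r) p      ≡⟨ total-swap (λ m n → f (m ∙ n)) p r ⟩
    total (λ n → total (λ m → f (m ∙ n)) p) r      ≡⟨ total-cong (λ n → total-cong (λ m → cong f (comm m n)) p) r ⟩
    total (λ n → total (λ m → f (n ∙ m)) p) r      ≡⟨ total-⊗ f r p ⟨
    total f (r ⊗ p)                                ∎) ⟩
    where open ≡-Reasoning

  ⊗-assoc : ∀ p r s → ((p ⊗ r) ⊗ s) ≈ (p ⊗ (r ⊗ s))
  ⊗-assoc p r s = ⟨ (λ f → begin
    total f ((p ⊗ r) ⊗ s)                                               ≡⟨ total-⊗ f (p ⊗ r) s ⟩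
    total (λ m → total (λ n → f (m ∙ n)) s) (p ⊗ r)                     ≡⟨ total-⊗ _ p r ⟩
    total (λ m → total (λ m′ → total (λ n → f ((m ∙ m′) ∙ n)) s) r) p
      ≡⟨ total-cong (λ m → trans (total-cong (λ m′ → total-cong (λ n → cong f (assoc m m′ n)) s) r) (sym (total-⊗ (λ n → f (m ∙ n)) r s))) p ⟩
    total (λ m → total (λ n → f (m ∙ n)) (r ⊗ s)) p                     ≡⟨ total-⊗ f p (r ⊗ s) ⟨
    total f (p ⊗ (r ⊗ s))                                               ∎) ⟩
    where open ≡-Reasoning

  ⊗-identityˡ : ∀ p → ([ ε ] ⊗ p) ≈ p
  ⊗-identityˡ p = ⟨ (λ f → trans (total-⊗ f [ ε ] p) (trans (ℕₚ.+-identityʳ _) (total-cong (λ m → cong f (identityˡ m)) p))) ⟩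

  ⊗-isCommutativeMonoid : IsCommutativeMonoid _≈_ _⊗_ [ ε ]
  ⊗-isCommutativeMonoid = record
    { isMonoid = record
      { isSemigroup = record
        { isMagma = record
          { isEquivalence = ≈-isEquivalence
          ; ∙-cong = λ {p} {p′} {r} {r′} e e′ → ⟨ (λ f →
              trans (total-⊗ f p r) (trans (at e _) (trans (total-cong (λ m → at e′ _) p′) (sym (total-⊗ f p′ r′))))) ⟩
          }
        ; assoc = ⊗-assoc
        }
      ; identity = ⊗-identityˡ , (λ p → IsEquivalence.trans ≈-isEquivalence (⊗-comm p [ ε ]) (⊗-identityˡ p))
      }
    ; comm = ⊗-comm
    }

  formalSums : CommutativeSemiring 0ℓ 0ℓ
  formalSums = record
    { isCommutativeSemiring = isCommutativeSemiringˡ (record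
      { +-isCommutativeMonoid = ++-isCommutativeMonoid
      ; *-isCommutativeMonoid = ⊗-isCommutativeMonoid
      ; distribʳ = λ s p r → ⟨ (λ f → trans (total-⊗ f (p ++ r) s) (trans (total-++ _ p r)
                     (sym (trans (total-++ f (p ⊗ s) (r ⊗ s)) (cong₂ ℕ._+_ (total-⊗ f p s) (total-⊗ f r s)))))) ⟩
      ; zeroˡ = λ p → ⟨ (λ f → refl) ⟩
      })
    }

-- Specialisation to monomials.

+-isCM : ∀ n → IsCommutativeMonoid _≡_ (zipWith {n = n} ℕ._+_) (replicate n 0)
+-isCM n = record
  { isMonoid = record
    { isSemigroup = record
      { isMagma = record { isEquivalence = isEquivalence ; ∙-cong = cong₂ (zipWith ℕ._+_) }
      ; assoc = Vecₚ.zipWith-assoc ℕₚ.+-assoc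
      }
    ; identity = Vecₚ.zipWith-identityˡ ℕₚ.+-identityˡ , Vecₚ.zipWith-identityʳ ℕₚ.+-identityʳ
    }
  ; comm = Vecₚ.zipWith-comm ℕₚ.+-comm
  }

multiplicities : ∀ n → List ℕ → Vec ℕ n
multiplicities n xs = tabulate (λ i → count (suc (toℕ i)) xs)

-- A monomial records the exponent of q followed by the exponents of the n letters.
module Monomials (n : ℕ) where
  open FormalSums (zipWith {n = suc n} ℕ._+_) (replicate (suc n) 0) (+-isCM (suc n))
  q : List (Vec ℕ (suc n))
  q = [ 1 ∷ replicate n 0 ]
  open GeneratingFunctions formalSums q
  open import Algebra.Properties.Semiring.Exp (CommutativeSemiring.semiring formalSums) using (_^_)

  letter : ℕ → List (Vec ℕ (suc n))
  letter x = [ 0 ∷ multiplicities n [ x ] ]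

  tabulate-0 : ∀ m → tabulate {n = m} (λ _ → 0) ≡ replicate m 0
  tabulate-0 zero    = refl
  tabulate-0 (suc m) = cong (0 ∷_) (tabulate-0 m)

  zipWith-tabulate : ∀ {m} (f g : Fin m → ℕ) → zipWith ℕ._+_ (tabulate f) (tabulate g) ≡ tabulate (λ i → f i ℕ.+ g i)
  zipWith-tabulate {zero}  f g = refl
  zipWith-tabulate {suc m} f g = cong (f fzero ℕ.+ g fzero ∷_) (zipWith-tabulate (f ∘ fsuc) (g ∘ fsuc))

  weight-letter : ∀ xs → weight letter xs ≡ [ 0 ∷ multiplicities n xs ]
  weight-letter []       = cong (λ v → [ 0 ∷ v ]) (sym (tabulate-0 n))
  weight-letter (x ∷ xs) rewrite weight-letter xs = cong (λ v → [ 0 ∷ v ])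
    (trans (zipWith-tabulate {n} _ _) (Vecₚ.tabulate-cong (λ i → cong (ℕ._+ count (suc (toℕ i)) xs) (ℕₚ.+-identityʳ _))))

  q^ : ∀ s → q ^ s ≡ [ s ∷ replicate n 0 ]
  q^ zero    = refl
  q^ (suc s) rewrite q^ s = cong (λ v → [ suc s ∷ v ]) (Vecₚ.zipWith-identityˡ ℕₚ.+-identityˡ (replicate n 0))

  monomial : ∀ xs s → weight letter xs ⊗ (q ^ s) ≡ [ s ∷ multiplicities n xs ]
  monomial xs s rewrite weight-letter xs | q^ s =
    cong (λ v → [ s ∷ v ]) (Vecₚ.zipWith-identityʳ ℕₚ.+-identityʳ (multiplicities n xs))

  total-∑ : ∀ f (stat : List (List ℕ) → ℕ) P →
    total f (∑ (λ μ → weight letter (concat μ) ⊗ (q ^ stat μ)) P) ≡ sum (map (λ μ → f (stat μ ∷ multiplicities n (concat μ))) P)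
  total-∑ f stat []      = refl
  total-∑ f stat (μ ∷ P) rewrite monomial (concat μ) (stat μ) =
    cong (f (stat μ ∷ multiplicities n (concat μ)) ℕ.+_) (total-∑ f stat P)

  -- The function `f` sees the statistic and the weight jointly, so an indicator can fix both.
  equidistributed : ∀ {L} → Increasing L → All (_≤ n) L → ∀ k f →
    sum (map (λ μ → f (inv μ ∷ multiplicities n (concat μ))) (partitions L k)) ≡
    sum (map (λ μ → f (cost 0 μ n ∷ multiplicities n (concat μ))) (partitions L k))
  equidistributed {L} inc L≤n k f =
    trans (sym (total-∑ f inv (partitions L k)))
      (trans (_≈_.at (inv-cost-GF inc L≤n k letter) f) (total-∑ f (λ μ → cost 0 μ n) (partitions L k)))

-- The enumeration is complete and free of repetitions.

letters : ℕ → List ℕ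
letters n = applyUpTo suc n

letters-increasing : ∀ n → Increasing (letters n)
letters-increasing n = AllPairsₚ.applyUpTo⁺₁ suc n (λ i<j _ → s≤s i<j)

blocks-increasing : ∀ {as} → Increasing as → All Increasing (blocks as)
blocks-increasing []           = []
blocks-increasing (a<as ∷ inc) = Allₚ.++⁺
  (Allₚ.map⁺ (([] ∷ []) ∷ All.zipWith (λ (a<B , i) → a<B ∷ i) (blocks-All a<as , blocks-increasing inc)))
  (blocks-increasing inc)

∈-blocks : ∀ {as b B} → Increasing as → Increasing (b ∷ B) → All (_∈ as) (b ∷ B) → b ∷ B ∈ blocks as
∈-blocks {[]}     _            _            (() ∷ _)
∈-blocks {a ∷ as} (a<as ∷ inc) (b<B ∷ incB) (here refl ∷ B∈) =
  ∈ₚ.∈-++⁺ˡ (∈ₚ.∈-map⁺ (a ∷_) (rest _ incB (All.zipWith (λ (b<x , x∈) → later b<x x∈) (b<B , B∈))))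
  where
  later : ∀ {x} → a < x → x ∈ a ∷ as → x ∈ as
  later a<x (here refl) = ⊥-elim (<-irrefl refl a<x)
  later a<x (there x∈)  = x∈
  rest : ∀ B → Increasing B → All (_∈ as) B → B ∈ [] ∷ blocks as
  rest []      _    _  = here refl
  rest (_ ∷ _) incB B∈ = there (∈-blocks inc incB B∈)
∈-blocks {a ∷ as} (a<as ∷ inc) (b<B ∷ incB) (there b∈ ∷ B∈) =
  ∈ₚ.∈-++⁺ʳ (map (a ∷_) ([] ∷ blocks as)) (∈-blocks inc (b<B ∷ incB) (b∈ ∷ All.zipWith (λ (b<x , x∈) → later b<x x∈) (b<B , B∈)))
  where
  later : ∀ {x} → _ < x → x ∈ a ∷ as → x ∈ as
  later b<x (here refl) = ⊥-elim (<-asym b<x (All.lookup a<as b∈))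
  later b<x (there x∈)  = x∈

-- The blocks with `a` and those without it are disjoint, since `a` is smaller than every letter of
-- `as`.
blocks-unique : ∀ {as} → Increasing as → Unique (blocks as)
blocks-unique []                      = []
blocks-unique {a ∷ as} (a<as ∷ inc) = Uniqueₚ.++⁺
  (Uniqueₚ.map⁺ Listₚ.∷-injectiveʳ (All.map (λ ne e → ne (sym e)) (blocks-nonEmpty as) ∷ blocks-unique inc))
  (blocks-unique inc) disjoint
  where
  disjoint : ∀ {B} → B ∈ map (a ∷_) ([] ∷ blocks as) × B ∈ blocks as → _
  disjoint (p , B∈) with ∈ₚ.∈-map⁻ (a ∷_) p
  ... | _ , _ , refl with All.lookup (blocks-All a<as) B∈
  ...   | a<a ∷ _ = <-irrefl refl a<a

partitions-unique : ∀ {L} → Increasing L → ∀ k → Unique (partitions L k)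
partitions-unique inc zero    = [] ∷ []
partitions-unique inc (suc k) = Uniqueₚ.cartesianProductWith⁺ (λ B μ → μ ∷ʳ B)
  (λ {B} {C} {μ} {ν} e → Product.swap (Listₚ.∷ʳ-injective μ ν e)) (blocks-unique inc) (partitions-unique inc k)

∈-partitions⁺ : ∀ {L} k {μ} → All (_∈ blocks L) μ → length μ ≡ k → μ ∈ partitions L k
∈-partitions⁺ k {μ} all len with initLast μ
∈-partitions⁺ zero    all len | []      = here refl
∈-partitions⁺ zero    all len | μ ∷ʳ′ B with () ← trans (sym (Listₚ.length-++-sucʳ μ B [])) len
∈-partitions⁺ (suc k) all len | μ ∷ʳ′ B with Allₚ.∷ʳ⁻ {xs = μ} all
... | allμ , B∈ = ∈ₚ.∈-cartesianProductWith⁺ (λ B μ → μ ∷ʳ B) B∈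
  (∈-partitions⁺ k allμ (suc-injective (trans (sym (trans (Listₚ.length-++ μ) (ℕₚ.+-comm (length μ) 1))) len)))

∈-partitions⁻ : ∀ {L} k {μ} → μ ∈ partitions L k → All (_∈ blocks L) μ × length μ ≡ k
∈-partitions⁻ zero (here refl) = [] , refl
∈-partitions⁻ {L} (suc k) μ∈ with ∈ₚ.∈-cartesianProductWith⁻ (λ B μ → μ ∷ʳ B) (blocks L) (partitions L k) μ∈
... | B , μ , B∈ , μ∈′ , refl with ∈-partitions⁻ k μ∈′
...   | all , len = Allₚ.∷ʳ⁺ all B∈ , trans (Listₚ.length-++ μ) (trans (ℕₚ.+-comm (length μ) 1) (cong suc len))

-- Translation of the Boolean definitions.

open Equivalence using (to; from)

T-strictInc : ∀ {B} → T (strictInc B) → Increasing B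
T-strictInc t = Linkedₚ.Linked⇒AllPairs <-trans (go _ t)
  where
  go : ∀ B → T (strictInc B) → Linked _<_ B
  go []          _ = []
  go (x ∷ [])    _ = [-]
  go (x ∷ y ∷ B) t = <ᵇ⇒< x y (proj₁ (to T-∧ t)) ∷ go (y ∷ B) (proj₂ (to (T-∧ {x <ᵇ y}) t))

strictInc-T : ∀ {B} → Increasing B → T (strictInc B)
strictInc-T []                              = tt
strictInc-T ([] ∷ [])                       = tt
strictInc-T {x ∷ y ∷ _} ((x<y ∷ _) ∷ inc) = from T-∧ (<⇒<ᵇ x<y , strictInc-T inc)

T-allPos : ∀ B → T (allPos B) → All (0 <_) B
T-allPos []          _ = []
T-allPos (suc x ∷ B) t = s≤s z≤n ∷ T-allPos B t

allPos-T : ∀ {B} → All (0 <_) B → T (allPos B)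
allPos-T []                     = tt
allPos-T {suc x ∷ B} (_ ∷ pos) = allPos-T pos

T-allLe : ∀ m xs → T (allLe m xs) → All (_≤ m) xs
T-allLe m []       _ = []
T-allLe m (x ∷ xs) t with to (T-∧ {x <ᵇ suc m}) t
... | x≤m , t′ = ℕ.s≤s⁻¹ (<ᵇ⇒< x (suc m) x≤m) ∷ T-allLe m xs t′

allLe-T : ∀ {m xs} → All (_≤ m) xs → T (allLe m xs)
allLe-T []        = tt
allLe-T (p ∷ ps) = from T-∧ (<⇒<ᵇ (s≤s p) , allLe-T ps)

∈-letters : ∀ {n x} → 0 < x → x ≤ n → x ∈ letters n
∈-letters {x = suc x} _ x≤n = ∈ₚ.∈-applyUpTo⁺ suc x≤n

T-isBlock : ∀ {n B} → T (isBlock B) → All (_≤ n) B → B ∈ blocks (letters n)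
T-isBlock {n} {b ∷ B} t B≤n with to (T-∧ {strictInc (b ∷ B)}) t
... | s , p = ∈-blocks (letters-increasing n) (T-strictInc s)
  (All.zipWith (λ (0<x , x≤n) → ∈-letters 0<x x≤n) (T-allPos (b ∷ B) p , B≤n))

isBlock-T : ∀ {n B} → B ∈ blocks (letters n) → T (isBlock B)
isBlock-T {n} {B} B∈ = go (All.lookup (blocks-nonEmpty (letters n)) B∈)
  (All.lookup (blocks-increasing (letters-increasing n)) B∈)
  (All.lookup (blocks-All (Allₚ.applyUpTo⁺₂ suc n (λ _ → s≤s z≤n))) B∈)
  where
  go : ∀ {B} → NonEmpty B → Increasing B → All (0 <_) B → T (isBlock B)
  go {[]}    ne _   _   = ⊥-elim (ne refl)
  go {_ ∷ _} _  inc pos = from T-∧ (strictInc-T inc , allPos-T pos)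

T-allBlocks : ∀ {n} μ → T (allBlocks μ) → All (_≤ n) (concat μ) → All (_∈ blocks (letters n)) μ
T-allBlocks []      _ _  = []
T-allBlocks (B ∷ μ) t ≤n with to (T-∧ {isBlock B}) t
... | b , t′ = T-isBlock b (Allₚ.++⁻ˡ B ≤n) ∷ T-allBlocks μ t′ (Allₚ.++⁻ʳ B ≤n)

allBlocks-T : ∀ {n μ} → All (_∈ blocks (letters n)) μ → T (allBlocks μ)
allBlocks-T []        = tt
allBlocks-T {n} (B∈ ∷ all) = from T-∧ (isBlock-T {n} B∈ , allBlocks-T {n} all)

letters-≤ : ∀ {n} → All (_≤ n) (letters n)
letters-≤ {n} = Allₚ.applyUpTo⁺₁ suc n id

concat-≤ : ∀ {n μ} → All (_∈ blocks (letters n)) μ → All (_≤ n) (concat μ)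
concat-≤ {n} all = Allₚ.concat⁺ (All.map (All.lookup (blocks-All letters-≤)) all)

T-all : ∀ (e : ℕ → Bool) l → T (foldr (λ i r → e i ∧ r) true l) → All (T ∘ e) l
T-all e []      _ = []
T-all e (i ∷ l) t with to (T-∧ {e i}) t
... | ti , t′ = ti ∷ T-all e l t′

all-T : ∀ (e : ℕ → Bool) {l} → All (T ∘ e) l → T (foldr (λ i r → e i ∧ r) true l)
all-T e []        = tt
all-T e (t ∷ ts) = from T-∧ (t , all-T e ts)

prescribed : (β : List ℕ) → Vec ℕ (length β)
prescribed β = tabulate (λ i → mult β (suc (toℕ i)))

module _ (β : List ℕ) (k : ℕ) where
  private
    n = length β
    L = letters n

  minimaj≡cost : ∀ {μ} → μ ∈ partitions L k → minimaj μ ≡ cost 0 μ n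
  minimaj≡cost μ∈ with ∈-partitions⁻ k μ∈
  ... | all , _ = minimaj-cost n
    (All.map (All.lookup (blocks-increasing (letters-increasing n))) all)
    (All.map (All.lookup (blocks-nonEmpty L)) all) (concat-≤ all)

  isOP⇒∈ : ∀ {μ} → T (isOP β k μ) → μ ∈ partitions L k
  isOP⇒∈ {μ} t with to (T-∧ {allBlocks μ}) t
  ... | b , t′ with to (T-∧ {hasWeight β μ}) t′
  ...   | w , len with to (T-∧ {allLe n (concat μ)}) w
  ...     | le , _ = ∈-partitions⁺ k (T-allBlocks μ b (T-allLe n (concat μ) le)) (≡ᵇ⇒≡ (length μ) k len)

  -- Membership in the enumeration already settles the shape of the blocks, their number and the
  -- bound on the letters; the weight remains, as an equality of exponent vectors.
  isOP⇔ : ∀ {μ} → μ ∈ partitions L k → T (isOP β k μ) ⇔ multiplicities n (concat μ) ≡ prescribed β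
  isOP⇔ {μ} μ∈ with ∈-partitions⁻ k μ∈
  ... | all , len = mk⇔ forth back
    where
    e : ℕ → Bool
    e i = count (suc i) (concat μ) ≡ᵇ mult β (suc i)
    forth : T (isOP β k μ) → multiplicities n (concat μ) ≡ prescribed β
    forth t = Vecₚ.tabulate-cong (λ i → ≡ᵇ⇒≡ _ _ (Allₚ.applyUpTo⁻ id n counts (toℕ<n i)))
      where
      counts : All (T ∘ e) (upTo n)
      counts = T-all e (upTo n) (proj₂ (to (T-∧ {allLe n (concat μ)}) (proj₁ (to (T-∧ {hasWeight β μ}) (proj₂ (to (T-∧ {allBlocks μ}) t))))))
    back : multiplicities n (concat μ) ≡ prescribed β → T (isOP β k μ)
    back eq = from T-∧ (allBlocks-T {n} all , from T-∧ (from T-∧ (allLe-T (concat-≤ all) , all-T e (Allₚ.applyUpTo⁺₁ id n at)) , ≡⇒≡ᵇ (length μ) k len))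
      where
      at : ∀ {i} → i < n → T (e i)
      at {i} i<n = ≡⇒≡ᵇ _ _ (subst (λ j → count (suc j) (concat μ) ≡ mult β (suc j)) (toℕ-fromℕ< i<n)
        (trans (sym (Vecₚ.lookup∘tabulate _ (fromℕ< i<n))) (trans (cong (λ v → Vec.lookup v (fromℕ< i<n)) eq) (Vecₚ.lookup∘tabulate _ (fromℕ< i<n)))))

-- From equal coefficients to a bijection.

length-filter : ∀ {A : Set} {P : A → Set} (P? : ∀ x → Dec (P x)) l →
                length (filter P? l) ≡ sum (map (λ x → if does (P? x) then 1 else 0) l)
length-filter P? [] = refl
length-filter P? (x ∷ l) with does (P? x)
... | true  = cong suc (length-filter P? l)
... | false = length-filter P? l

-- In a list without repetitions membership proofs are unique, so an element and its position in the
-- filtered list determine each other.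
Σ↔Fin : ∀ {A : Set} {P : A → Set} (P? : ∀ x → Dec (P x)) → (∀ {x} (p p′ : P x) → p ≡ p′) →
        ∀ {l} → Unique l → (∀ {x} → P x → x ∈ l) → Σ A P ↔ Fin (length (filter P? l))
Σ↔Fin {A} {P} P? irr {l} uniq complete = mk↔ₛ′ forth back forth-back back-forth
  where
  l′ = filter P? l
  member : ∀ {x} → P x → x ∈ l′
  member p = ∈ₚ.∈-filter⁺ P? (complete p) p
  forth : Σ A P → Fin (length l′)
  forth (x , p) = index (member p)
  back : Fin (length l′) → Σ A P
  back i = lookup l′ i , proj₂ (∈ₚ.∈-filter⁻ P? {xs = l} (∈ₚ.∈-lookup {xs = l′} i))
  index-∈-lookup : ∀ (xs : List A) i → index (∈ₚ.∈-lookup {xs = xs} i) ≡ i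
  index-∈-lookup (x ∷ xs) fzero    = refl
  index-∈-lookup (x ∷ xs) (fsuc i) = cong fsuc (index-∈-lookup xs i)
  forth-back : ∀ i → forth (back i) ≡ i
  forth-back i = trans (cong index (unique⇒irrelevant (Uniqueₚ.filter⁺ P? uniq) _ (∈ₚ.∈-lookup {xs = l′} i))) (index-∈-lookup l′ i)
  Σ-≡ : ∀ {x y} (p : P x) (p′ : P y) → x ≡ y → (x , p) ≡ (y , p′)
  Σ-≡ p p′ refl = cong (_ ,_) (irr p p′)
  back-forth : ∀ s → back (forth s) ≡ s
  back-forth (x , p) = Σ-≡ _ p (sym (lookup-index (member p)))

theorem3p17 : (β : List ℕ) (k d : ℕ) →
    (Σ (List (List ℕ)) (λ μ → T (isOP β k μ) × inv μ ≡ d)) ↔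
    (Σ (List (List ℕ)) (λ μ → T (isOP β k μ) × minimaj μ ≡ d))
theorem3p17 β k d = ↔-trans
  (subst (λ N → Σ (List (List ℕ)) (λ μ → T (isOP β k μ) × inv μ ≡ d) ↔ Fin N) same-number (enumerate inv))
  (↔-sym (enumerate minimaj))
  where
  n = length β
  P = partitions (letters n) k
  has? : (stat : List (List ℕ) → ℕ) → ∀ μ → Dec (T (isOP β k μ) × stat μ ≡ d)
  has? stat μ = T? (isOP β k μ) ×-dec (stat μ ≟ d)
  enumerate : ∀ stat → Σ (List (List ℕ)) (λ μ → T (isOP β k μ) × stat μ ≡ d) ↔ Fin (length (filter (has? stat) P))
  enumerate stat = Σ↔Fin (has? stat) (λ (t , e) (t′ , e′) → cong₂ _,_ (T-irrelevant t t′) (≡-irrelevant e e′))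
    (partitions-unique (letters-increasing n) k) (λ (t , _) → isOP⇒∈ β k t)
  _≟ᵛ_ = Vecₚ.≡-dec {n = suc n} _≟_
  -- Extracts the coefficient at exponent `d` of `q` and exponents `β` of the letters.
  indicator : Vec ℕ (suc n) → ℕ
  indicator v = if does (v ≟ᵛ (d ∷ prescribed β)) then 1 else 0
  -- The second statistic lets `minimaj` be replaced on the enumeration by `cost`, to which the
  -- generating functions apply.
  number : ∀ stat (stat′ : List (List ℕ) → ℕ) → (∀ {μ} → μ ∈ P → stat μ ≡ stat′ μ) →
    length (filter (has? stat) P) ≡ sum (map (λ μ → indicator (stat′ μ ∷ multiplicities n (concat μ))) P)
  number stat stat′ agree = trans (length-filter (has? stat) P) (cong sum (Listₚ.map-cong-local (All.tabulate term)))
    where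
    term : ∀ {μ} → μ ∈ P → (if does (has? stat μ) then 1 else 0) ≡ indicator (stat′ μ ∷ multiplicities n (concat μ))
    term {μ} μ∈ = cong (λ b → if b then 1 else 0) (does-⇔ (mk⇔
      (λ (t , e) → cong₂ _∷_ (trans (sym (agree μ∈)) e) (to (isOP⇔ β k μ∈) t))
      (λ e → from (isOP⇔ β k μ∈) (Vecₚ.∷-injectiveʳ e) , trans (agree μ∈) (Vecₚ.∷-injectiveˡ e)))
      (has? stat μ) ((stat′ μ ∷ multiplicities n (concat μ)) ≟ᵛ (d ∷ prescribed β)))
  same-number : length (filter (has? inv) P) ≡ length (filter (has? minimaj) P)
  same-number = trans (number inv inv (λ _ → refl)) (trans
    (Monomials.equidistributed n (letters-increasing n) letters-≤ k indicator)
    (sym (number minimaj (λ μ → cost 0 μ n) (minimaj≡cost β k))))
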